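{- Let $0 \leq p \leq q$ be integers, and let $i \in \{1,2,3,4,5\}$ be the integer with $i \equiv p+q \pmod 5$. Then $$\eta[CS_4(\mathcal{P}_4 : p, 1, q, 1)] = \begin{cases} 1 & \text{if } p = q,\\[2pt] \frac{4}{5}(p+q-i) + 2\left\lfloor \frac{i}{4}\right\rfloor & \text{if } p < q < 2p - \left\lfloor \frac{|p-2|}{2}\right\rfloor,\\[2pt] 2p & \text{if } q > p \text{ and } q \geq 2p - \left\lfloor \frac{|p-2|}{2}\right\rfloor. \end{cases}$$
   Context: $\mathcal{P}_4$ is the family of planar graphs of girth at least $4$ (a pair of parallel edges counts as a cycle of length 2). The Circular sprout game $CS_n(\mathcal{P}_4:t_1,\dots,t_n)$ is the following two-player game. Initially $n$ dots $v_1,\dots,v_n$ are arranged in clockwise order on a circle, $v_i$ having $t_i \ge 0$ open tips (short free partial edges) coming out into the interior of the circle. The players move alternately. A valid move consists of joining two distinct open tips by a curve lying entirely in the interior of the circle and crossing neither itself nor any previously drawn curve, and then drawing a crossbar on this curve: the intersection of the crossbar with the curve is a new vertex, which has two new open tips, one on each side of the curve. The two joined tips are no longer open. The associated graph has as vertices the dots and the curve/crossbar intersections, and as edges the curve pieces joining two such vertices together with the arcs of the circle between consecutive dots; it must belong to $\mathcal{P}_4$ at all times. The first player unable to make a valid move loses. For a finite impartial game $X$, $\eta[X]$ denotes its nimber: positions with no move have nimber $0$, and every other position has nimber equal to the least non-negative integer that is not the nimber of a position reachable in one move. -}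

module Defs where

open import Data.Fin using (Fin; toℕ)
open import Data.List
  using (List; []; _∷_; [_]; _++_; concat; length; lookup; replicate; tabulate)
open import Data.Nat using (ℕ; suc; _≤_; _<_)
open import Data.Nat.DivMod using (_mod_)
open import Data.Nat.Properties using (<-cmp)
open import Data.Product using (_×_; _,_; proj₁; proj₂; ∃-syntax)
open import Data.Sum using (_⊎_)
open import Data.Vec as Vec using (Vec)
open import Function.Definitions using (Injective)
open import Level using (0ℓ)
open import Relation.Binary.Core using (Rel)
open import Relation.Binary.Definitions using (tri<; tri≈; tri>)
open import Relation.Binary.PropositionalEquality using (_≡_; _≢_)
open import Relation.Nullary.Negation using (contradiction)

record Game : Set₁ where
  field
    Position : Set
    _⟶_      : Rel Position 0ℓ
    start    : Position

-- "x has nimber k": k is the mex of the nimbers of the options of x.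
-- The second field asks every option to have a nimber different from k,
-- rather than not to have nimber k.  This keeps the definition inductive, so
-- that only positions admitting no infinite play have a nimber.
data Nimber {A : Set} (_⟶_ : Rel A 0ℓ) (x : A) (k : ℕ) : Set where
  mex : (∀ j → j < k → ∃[ y ] (x ⟶ y × Nimber _⟶_ y j)) →
        (∀ y → x ⟶ y → ∃[ j ] (Nimber _⟶_ y j × j ≢ k)) →
        Nimber _⟶_ x k

Nimber-unique : ∀ {A : Set} {_⟶_ : Rel A 0ℓ} {x : A} {j k : ℕ} →
                Nimber _⟶_ x j → Nimber _⟶_ x k → j ≡ k
Nimber-unique {j = j} {k} (mex below₁ avoid₁) (mex below₂ avoid₂) with <-cmp j k
... | tri≈ _ j≡k _ = j≡k
... | tri< j<k _ _ with below₂ j j<k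
...   | y , x⟶y , ηy with avoid₁ y x⟶y
...     | _ , ηy′ , ≢j = contradiction (Nimber-unique ηy′ ηy) ≢j
Nimber-unique {j = j} {k} (mex below₁ avoid₁) (mex below₂ avoid₂)
    | tri> _ _ k<j with below₁ k k<j
...   | y , x⟶y , ηy with avoid₂ y x⟶y
...     | _ , ηy′ , ≢k = contradiction (Nimber-unique ηy′ ηy) ≢k

infix 4 η[_]=_

-- By Nimber-unique this relation is the graph of a partial function η.
η[_]=_ : Game → ℕ → Set
η[ X ]= k = Nimber _⟶_ start k
  where open Game X

-- Finite multigraphs with loops; the vertices are 0, …, order - 1, and each
-- list entry is one edge.
record Graph : Set where
  constructor mkGraph
  field
    order : ℕ
    edges : List (ℕ × ℕ)

open Graph public

Joins : ℕ × ℕ → ℕ → ℕ → Set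
Joins e u v = (proj₁ e ≡ u × proj₂ e ≡ v) ⊎ (proj₁ e ≡ v × proj₂ e ≡ u)

next : ∀ {n} → Fin n → Fin n
next {suc n} i = suc (toℕ i) mod suc n

-- Edges are referred to by their index in the list, so a loop is a cycle of
-- length 1 and a pair of parallel edges is a cycle of length 2.
record Cycle (G : Graph) (k : ℕ) : Set where
  field
    vertex     : Fin k → ℕ
    edge       : Fin k → Fin (length (edges G))
    vertex-inj : Injective _≡_ _≡_ vertex
    edge-inj   : Injective _≡_ _≡_ edge
    joins      : ∀ i → Joins (lookup (edges G) (edge i)) (vertex i) (vertex (next i))

GirthAtLeast : ℕ → Graph → Set
GirthAtLeast g G = ∀ k → Cycle G (suc k) → g ≤ suc k

-- The family of planar graphs of girth at least 4.  Planarity is not repeated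
-- as a conjunct: this family is only applied to graphs of positions, and a
-- position is a crossing-free drawing of its graph.
𝒫₄ : Graph → Set
𝒫₄ = GirthAtLeast 4

-- The curves cut the interior of the circle into topological discs.  Up to
-- isotopy a drawing is determined by what lies along the boundary of each
-- disc.  A region records the cyclic order (cut open at an arbitrary place) of
-- the open tips pointing into that disc, each given by the vertex carrying it.
Region : Set
Region = List ℕ

record Position : Set where
  constructor mkPosition
  field
    graph   : Graph
    regions : List Region

open Position public

-- Draw a curve from u to v whose crossbar is the new vertex.
addCurve : ℕ → ℕ → Graph → Graph
addCurve u v (mkGraph w es) = mkGraph (suc w) ((u , w) ∷ (w , v) ∷ es)

-- A curve joining two tips of the same region separates the tips lying between
-- them in the cyclic order (ys) from the others (zs followed by xs), and the
-- crossbar w puts one new tip on each side.  The vertices u and v may coincide: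
-- only the two tips have to be distinct.
data Move (𝒫 : Graph → Set) (P : Position) : Position → Set where
  join : ∀ ls rs xs ys zs u v →
         regions P ≡ ls ++ (xs ++ u ∷ ys ++ v ∷ zs) ∷ rs →
         𝒫 (addCurve u v (graph P)) →
         let w = order (graph P) in
         Move 𝒫 P (mkPosition (addCurve u v (graph P))
                              (ls ++ (ys ++ [ w ]) ∷ (xs ++ w ∷ zs) ∷ rs))

-- The circular sprout game; the dots v₁, …, vₙ are the vertices 0, …, n - 1.
CS : (n : ℕ) → (Graph → Set) → Vec ℕ n → Game
CS n 𝒫 t = record
  { Position = Position
  ; _⟶_      = Move 𝒫
  ; start    = mkPosition
      (mkGraph n (tabulate {n = n} λ i → toℕ i , toℕ (next i)))
      [ concat (tabulate λ i → replicate (Vec.lookup t i) (toℕ i)) ]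
  }

{-# OPTIONS --safe #-}
module Submission where

-- Only tips at opposite corners of a quadrilateral can ever be joined: the graph
-- stays bipartite and without parallel edges, hence in 𝒫₄, while joining adjacent
-- corners would close a triangle.  A region with p, 1, q, 1 tips therefore either
-- splits into regions a, 1, b, 1 and p-1-a, 1, q-1-b, 1, or (joining the two single
-- tips) into two regions allowing at most one further move each.  So the game is a
-- disjunctive sum, and g(p,q) is the mex of [p>0] ⊕ [q>0] and of all
-- g(a,b) ⊕ g(p-1-a,q-1-b).  This gives g(p,p) = 1 and g(p,q) = 2 H(p,q) for p ≠ q,
-- where H(p,q) = min(p, q, ⌊2(p+q-1)/5⌋), except that H(1,2) = H(2,1) = 1.  By
-- x ⊕ y ≤ x + y and superadditivity of H, 2 H(p,q) is not the value of an option.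
-- Along suitable lines H grows in steps of at most 1, so all smaller values are; the
-- few even ones missed this way come from the exceptional values and H(0,1) = 0.

open import Defs
open import Data.Bool using (Bool; true; false; not; _xor_; if_then_else_)
open import Data.Bool.Properties using (xor-assoc; xor-comm; xor-same; ¬-not; not-¬)
open import Data.Empty using (⊥)
open import Data.List using (List; []; _∷_; [_]; _++_; replicate; lookup)
open import Data.List.Properties using (++-assoc; ++-identityʳ)
open import Data.Nat hiding (_/_; _%_)
open import Data.Nat.DivMod
open import Data.Nat.Induction using (<-wellFounded)
open import Data.Nat.Properties
open import Data.Nat.Tactic.RingSolver using (solve; solve-∀)
open import Data.Product using (_×_; _,_; ∃-syntax; -,_; proj₁; proj₂)
open import Data.Sum using (_⊎_; inj₁; inj₂; swap)
open import Function using (_∘_)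
open import Induction.WellFounded using (Acc; acc)
open import Level using (0ℓ)
open import Relation.Binary.Core using (Rel)
open import Relation.Binary.Definitions using (tri<; tri≈; tri>)
open import Relation.Binary.PropositionalEquality
  using (_≡_; _≢_; refl; sym; trans; cong; cong₂; subst; subst₂; module ≡-Reasoning)
open import Relation.Nullary using (¬_; yes; no)
open import Relation.Nullary.Decidable using (does; dec-true; dec-false)
open import Relation.Nullary.Negation using (contradiction)

-- Nim addition

infixr 5 _∷₂_
_∷₂_ : Bool → ℕ → ℕ
false ∷₂ n = n + n
true  ∷₂ n = suc (n + n)

odd : ℕ → Bool
odd zero    = false
odd (suc n) = not (odd n)

odd-double : ∀ n → odd (n + n) ≡ false
odd-double zero = refl
odd-double (suc n) rewrite +-suc n n | odd-double n = refl

odd-∷₂ : ∀ b n → odd (b ∷₂ n) ≡ b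
odd-∷₂ false n = odd-double n
odd-∷₂ true  n = cong not (odd-double n)

half-suc-double : ∀ n → ⌊ suc (n + n) /2⌋ ≡ n
half-suc-double zero = refl
half-suc-double (suc n) rewrite +-suc n n = cong suc (half-suc-double n)

half-∷₂ : ∀ b n → ⌊ b ∷₂ n /2⌋ ≡ n
half-∷₂ false n = sym (n≡⌊n+n/2⌋ n)
half-∷₂ true  n = half-suc-double n

suc-∷₂ : ∀ b n → b ∷₂ suc n ≡ suc (suc (b ∷₂ n))
suc-∷₂ false n = cong suc (+-suc n n)
suc-∷₂ true  n = cong (λ m → suc (suc m)) (+-suc n n)

∷₂-odd-half : ∀ n → odd n ∷₂ ⌊ n /2⌋ ≡ n
∷₂-odd-half zero          = refl
∷₂-odd-half (suc zero)    = refl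
∷₂-odd-half (suc (suc n)) with odd n | ∷₂-odd-half n
... | false | eq = trans (suc-∷₂ false ⌊ n /2⌋) (cong (λ m → suc (suc m)) eq)
... | true  | eq = trans (suc-∷₂ true ⌊ n /2⌋) (cong (λ m → suc (suc m)) eq)

half-≤ : ∀ {n f} → n ≤ suc f → ⌊ n /2⌋ ≤ f
half-≤ {zero}  _         = z≤n
half-≤ {suc n} (s≤s n≤f) = ≤-trans (s≤s⁻¹ (⌊n/2⌋<n n)) n≤f

-- The first argument bounds the number of binary digits.
nimSum : ℕ → ℕ → ℕ → ℕ
nimSum zero    a b = 0
nimSum (suc f) a b = (odd a xor odd b) ∷₂ nimSum f ⌊ a /2⌋ ⌊ b /2⌋

infixl 6 _⊕_
_⊕_ : ℕ → ℕ → ℕ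
a ⊕ b = nimSum (a + b) a b

-- Halving turns a bound `suc f` into `f`, so a fuel bounding both arguments outlasts all nonzero
-- digits; digits computed beyond it are zero.
nimSum-fuel : ∀ {f f′} a b → a ≤ f → b ≤ f → f ≤ f′ → nimSum f′ a b ≡ nimSum f a b
nimSum-fuel {zero} {zero}   _ _ _ _ _ = refl
nimSum-fuel {zero} {suc f′} zero zero z≤n z≤n z≤n
  rewrite nimSum-fuel {zero} {f′} 0 0 z≤n z≤n z≤n = refl
nimSum-fuel {suc f} a b a≤ b≤ (s≤s f≤f′) =
  cong ((odd a xor odd b) ∷₂_) (nimSum-fuel ⌊ a /2⌋ ⌊ b /2⌋ (half-≤ a≤) (half-≤ b≤) f≤f′)

⊕-∷₂ : ∀ i a j b → (i ∷₂ a) ⊕ (j ∷₂ b) ≡ (i xor j) ∷₂ (a ⊕ b)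
⊕-∷₂ i a j b = begin
  nimSum f x y                                          ≡⟨ nimSum-fuel x y (m≤m+n x y) (m≤n+m y x) (n≤1+n f) ⟨
  (odd x xor odd y) ∷₂ nimSum f ⌊ x /2⌋ ⌊ y /2⌋          ≡⟨ cong₂ _∷₂_
                                                  (cong₂ _xor_ (odd-∷₂ i a) (odd-∷₂ j b))
                                                  (cong₂ (nimSum f) (half-∷₂ i a) (half-∷₂ j b)) ⟩
  (i xor j) ∷₂ nimSum f a b                             ≡⟨ cong ((i xor j) ∷₂_)
                                                             (nimSum-fuel a b (m≤m+n a b) (m≤n+m b a)
                                                               (+-mono-≤ (≤-∷₂ i a) (≤-∷₂ j b))) ⟩
  (i xor j) ∷₂ (a ⊕ b)                                  ∎
  where
  open ≡-Reasoning
  x = i ∷₂ a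
  y = j ∷₂ b
  f = x + y
  ≤-∷₂ : ∀ b n → n ≤ b ∷₂ n
  ≤-∷₂ false n = m≤m+n n n
  ≤-∷₂ true  n = m≤n⇒m≤1+n (m≤m+n n n)

binary-induction : (P : ℕ → ℕ → ℕ → Set) → P 0 0 0 →
                   (∀ i a j b l c → P a b c → P (i ∷₂ a) (j ∷₂ b) (l ∷₂ c)) →
                   ∀ a b c → P a b c
binary-induction P base step a b c =
  go (a + b + c) a b c (≤-trans (m≤m+n a b) (m≤m+n (a + b) c))
     (≤-trans (m≤n+m b a) (m≤m+n (a + b) c)) (m≤n+m c (a + b))
  where
  go : ∀ f a b c → a ≤ f → b ≤ f → c ≤ f → P a b c
  go zero    zero zero zero z≤n z≤n z≤n = base
  go (suc f) a b c a≤ b≤ c≤ =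
    subst (λ a → P a b c) (∷₂-odd-half a)
      (subst₂ (P _) (∷₂-odd-half b) (∷₂-odd-half c)
        (step (odd a) _ (odd b) _ (odd c) _ (go f ⌊ a /2⌋ ⌊ b /2⌋ ⌊ c /2⌋ (half-≤ a≤) (half-≤ b≤) (half-≤ c≤))))

⊕-assoc : ∀ a b c → (a ⊕ b) ⊕ c ≡ a ⊕ (b ⊕ c)
⊕-assoc = binary-induction _ refl λ i a j b l c ih → begin
  ((i ∷₂ a) ⊕ (j ∷₂ b)) ⊕ (l ∷₂ c)      ≡⟨ cong (_⊕ (l ∷₂ c)) (⊕-∷₂ i a j b) ⟩
  ((i xor j) ∷₂ (a ⊕ b)) ⊕ (l ∷₂ c)     ≡⟨ ⊕-∷₂ (i xor j) (a ⊕ b) l c ⟩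
  ((i xor j) xor l) ∷₂ (a ⊕ b ⊕ c)      ≡⟨ cong₂ _∷₂_ (xor-assoc i j l) ih ⟩
  (i xor (j xor l)) ∷₂ (a ⊕ (b ⊕ c))    ≡⟨ ⊕-∷₂ i a (j xor l) (b ⊕ c) ⟨
  (i ∷₂ a) ⊕ ((j xor l) ∷₂ (b ⊕ c))     ≡⟨ cong ((i ∷₂ a) ⊕_) (⊕-∷₂ j b l c) ⟨
  (i ∷₂ a) ⊕ ((j ∷₂ b) ⊕ (l ∷₂ c))      ∎
  where open ≡-Reasoning

⊕-comm : ∀ a b → a ⊕ b ≡ b ⊕ a
⊕-comm a b = binary-induction (λ a b _ → a ⊕ b ≡ b ⊕ a) refl
  (λ i a j b _ _ ih → trans (⊕-∷₂ i a j b)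
    (trans (cong₂ _∷₂_ (xor-comm i j) ih) (sym (⊕-∷₂ j b i a)))) a b 0

⊕-self : ∀ a → a ⊕ a ≡ 0
⊕-self a = binary-induction (λ a _ _ → a ⊕ a ≡ 0) refl
  (λ i a _ _ _ _ ih → trans (⊕-∷₂ i a i a) (cong₂ _∷₂_ (xor-same i) ih)) a 0 0

⊕-identityˡ : ∀ a → 0 ⊕ a ≡ a
⊕-identityˡ a = binary-induction (λ a _ _ → 0 ⊕ a ≡ a) refl
  (λ i a _ _ _ _ ih → trans (⊕-∷₂ false 0 i a) (cong (i ∷₂_) ih)) a 0 0

⊕-identityʳ : ∀ a → a ⊕ 0 ≡ a
⊕-identityʳ a = trans (⊕-comm a 0) (⊕-identityˡ a)

⊕-cancelˡ : ∀ a {b c} → a ⊕ b ≡ a ⊕ c → b ≡ c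
⊕-cancelˡ a {b} {c} eq = trans (sym (undo b)) (trans (cong (a ⊕_) eq) (undo c))
  where
  undo : ∀ b → a ⊕ (a ⊕ b) ≡ b
  undo b = trans (sym (⊕-assoc a a b)) (trans (cong (_⊕ b) (⊕-self a)) (⊕-identityˡ b))

⊕-cancelʳ : ∀ {a b} c → a ⊕ c ≡ b ⊕ c → a ≡ b
⊕-cancelʳ {a} {b} c eq = ⊕-cancelˡ c (trans (⊕-comm c a) (trans eq (⊕-comm b c)))

-- Nim addition is addition without carries; only the digit pair 1, 1 loses something.
⊕≤+ : ∀ a b → a ⊕ b ≤ a + b
⊕≤+ a b = binary-induction (λ a b _ → a ⊕ b ≤ a + b) z≤n
  (λ i a j b _ _ ih → subst (_≤ (i ∷₂ a) + (j ∷₂ b)) (sym (⊕-∷₂ i a j b))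
    (≤-trans (∷₂-mono (i xor j) ih) (digits i a j b))) a b 0
  where
  ∷₂-mono : ∀ b {m n} → m ≤ n → b ∷₂ m ≤ b ∷₂ n
  ∷₂-mono false m≤n = +-mono-≤ m≤n m≤n
  ∷₂-mono true  m≤n = s≤s (+-mono-≤ m≤n m≤n)

  interchange : ∀ a b → (a + b) + (a + b) ≡ (a + a) + (b + b)
  interchange = solve-∀

  digits : ∀ i a j b → (i xor j) ∷₂ (a + b) ≤ (i ∷₂ a) + (j ∷₂ b)
  digits false a false b = ≤-reflexive (interchange a b)
  digits false a true  b = ≤-reflexive (trans (cong suc (interchange a b)) (sym (+-suc (a + a) (b + b))))
  digits true  a false b = ≤-reflexive (cong suc (interchange a b))
  digits true  a true  b = ≤-trans (≤-reflexive (interchange a b))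
    (m≤n⇒m≤1+n (+-monoʳ-≤ (a + a) (n≤1+n (b + b))))

∷₂-mono-< : ∀ i j {m n} → m < n → i ∷₂ m < j ∷₂ n
∷₂-mono-< i j {m} {n} m<n = ≤-trans (upper i) (≤-trans (+-mono-≤ m<n m<n) (lower j))
  where
  upper : ∀ i → i ∷₂ m < suc m + suc m
  upper false = s≤s (+-monoʳ-≤ m (n≤1+n m))
  upper true  = s≤s (≤-reflexive (sym (+-suc m m)))
  lower : ∀ j → n + n ≤ j ∷₂ n
  lower false = ≤-refl
  lower true  = n≤1+n _

∷₂-<-cases : ∀ i j {m n} → i ∷₂ m < j ∷₂ n → m < n ⊎ (m ≡ n × i ≡ false × j ≡ true)
∷₂-<-cases i j {m} {n} lt with <-cmp m n
... | tri< m<n _ _ = inj₁ m<n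
... | tri> _ _ n<m = contradiction lt (<-asym (∷₂-mono-< j i n<m))
∷₂-<-cases false false lt | tri≈ _ refl _ = contradiction lt (<-irrefl refl)
∷₂-<-cases true  true  lt | tri≈ _ refl _ = contradiction lt (<-irrefl refl)
∷₂-<-cases true  false lt | tri≈ _ refl _ = contradiction (<-trans (n<1+n _) lt) (<-irrefl refl)
∷₂-<-cases false true  lt | tri≈ _ refl _ = inj₂ (refl , refl , refl)

-- At the highest digit where `k` and `a ⊕ b` differ, exactly one of `a` and `b` has digit 1. That
-- number is lowered there, and its lower digits are free to produce those of `k`.
⊕-reduce : ∀ a b k → k < a ⊕ b →
           (∃[ a′ ] (a′ < a × a′ ⊕ b ≡ k)) ⊎ (∃[ b′ ] (b′ < b × a ⊕ b′ ≡ k))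
⊕-reduce = binary-induction _ (λ ()) step
  where
  xor-cancelˡ : ∀ l i → i xor (i xor l) ≡ l
  xor-cancelˡ l false = refl
  xor-cancelˡ false true = refl
  xor-cancelˡ true  true = refl
  xor-cancelʳ : ∀ l j → (l xor j) xor j ≡ l
  xor-cancelʳ l j = trans (xor-assoc l j j) (trans (cong (l xor_) (xor-same j)) (xor-comm l false))
  step : ∀ i a j b l k →
         (k < a ⊕ b → (∃[ a′ ] (a′ < a × a′ ⊕ b ≡ k)) ⊎ (∃[ b′ ] (b′ < b × a ⊕ b′ ≡ k))) →
         l ∷₂ k < (i ∷₂ a) ⊕ (j ∷₂ b) →
         (∃[ a′ ] (a′ < i ∷₂ a × a′ ⊕ (j ∷₂ b) ≡ l ∷₂ k)) ⊎
         (∃[ b′ ] (b′ < j ∷₂ b × (i ∷₂ a) ⊕ b′ ≡ l ∷₂ k))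
  step i a j b l k ih lt with ∷₂-<-cases l (i xor j) (subst (l ∷₂ k <_) (⊕-∷₂ i a j b) lt)
  ... | inj₁ k< with ih k<
  -- A decrease in the higher digits leaves the last digit free, so it is set to whatever produces
  -- `l`.
  ...   | inj₁ (a′ , a′< , eq) = inj₁ ((l xor j) ∷₂ a′ , ∷₂-mono-< (l xor j) i a′< ,
            trans (⊕-∷₂ (l xor j) a′ j b) (cong₂ _∷₂_ (xor-cancelʳ l j) eq))
  ...   | inj₂ (b′ , b′< , eq) = inj₂ ((i xor l) ∷₂ b′ , ∷₂-mono-< (i xor l) j b′< ,
            trans (⊕-∷₂ i a (i xor l) b′) (cong₂ _∷₂_ (xor-cancelˡ l i) eq))
  step true a false b .false k ih lt | inj₂ (refl , refl , _) =
    inj₁ (false ∷₂ a , n<1+n _ , ⊕-∷₂ false a false b)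
  step false a true b .false k ih lt | inj₂ (refl , refl , _) =
    inj₂ (false ∷₂ b , n<1+n _ , ⊕-∷₂ false a false b)

-- The function H

infixl 6 _⊞_
_⊞_ : ∀ {a b c d} → a ≤ b → c ≤ d → a + c ≤ b + d
_⊞_ = +-mono-≤

infixl 7 _⊠_
_⊠_ : ∀ n {a b} → a ≤ b → n * a ≤ n * b
n ⊠ a≤b = *-monoʳ-≤ n a≤b

-- A Farkas certificate for x ≤ y: l ≤ r is a combination of the hypotheses, k a
-- nonnegative slack, and rounding allows an error of c after scaling by c + 1.
farkas : ∀ c k {x y l r} → l ≤ r → suc c * x + r + k ≡ suc c * y + (l + c) → x ≤ y
farkas c k {x} {y} {l} {r} l≤r eq =
  s≤s⁻¹ (*-cancelˡ-< (suc c) x (suc y) (+-cancelʳ-≤ r (suc (suc c * x)) (suc c * suc y) (begin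
    suc (suc c * x) + r            ≤⟨ m≤m+n _ k ⟩
    suc (suc c * x + r + k)        ≡⟨ cong suc eq ⟩
    suc (suc c * y + (l + c))      ≤⟨ s≤s (+-monoʳ-≤ (suc c * y) (+-monoˡ-≤ c l≤r)) ⟩
    suc (suc c * y + (r + c))      ≡⟨ regroup c y r ⟩
    suc c * suc y + r              ∎)))
  where
  open ≤-Reasoning
  regroup : ∀ c y r → suc (suc c * y + (r + c)) ≡ suc c * suc y + r
  regroup = solve-∀

-- The exceptional value at 3 makes H 1 2 ≡ 1.
capacity : ℕ → ℕ
capacity 3 = 1
capacity s = (2 * pred s) / 5

H : ℕ → ℕ → ℕ
H p q = p ⊓ q ⊓ capacity (p + q)

-- For positive `s` the hypothesis is the linear form of `k ≤ ⌊2(s-1)/5⌋`. The exceptional value at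
-- 3 lies above this floor, so the bound survives there.
capacity-lower : ∀ s k → 5 * k + 2 ≤ 2 * s → k ≤ capacity s
capacity-lower 0 k h = contradiction (≤-trans (m≤n+m 2 (5 * k)) h) λ ()
capacity-lower 3 k h = farkas 4 5 h (solve (k ∷ []))
capacity-lower 1 k h = farkas 4 4 h (solve (k ∷ []))
capacity-lower 2 k h = farkas 4 2 h (solve (k ∷ []))
capacity-lower (suc n@(suc (suc (suc _)))) k h =
  ≤-trans (≤-reflexive (sym (m*n/n≡m k 5))) (/-monoˡ-≤ 5 bound)
  where
  bound : k * 5 ≤ 2 * n
  bound = +-cancelʳ-≤ 2 (k * 5) (2 * n)
    (≤-trans (≤-reflexive (cong (_+ 2) (*-comm k 5))) (≤-trans h (≤-reflexive (shift n))))
    where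
    shift : ∀ n → 2 * suc n ≡ 2 * n + 2
    shift = solve-∀

capacity-upper : ∀ s → 1 ≤ s → 5 * capacity s + 2 ≤ 2 * s ⊎ s ≡ 3
capacity-upper 1 _ = inj₁ ≤-refl
capacity-upper 2 _ = inj₁ (m≤m+n 2 2)
capacity-upper 3 _ = inj₂ refl
capacity-upper (suc n@(suc (suc (suc _)))) _ = inj₁
  (≤-trans (+-monoˡ-≤ 2 (≤-trans (≤-reflexive (*-comm 5 (2 * n / 5))) (m/n*n≤m (2 * n) 5)))
           (≤-reflexive (shift n)))
  where
  shift : ∀ n → 2 * n + 2 ≡ 2 * suc n
  shift = solve-∀

H-lower : ∀ p q {k} → k ≤ p → k ≤ q → 5 * k + 2 ≤ 2 * (p + q) → k ≤ H p q
H-lower p q k≤p k≤q h = ⊓-glb (⊓-glb k≤p k≤q) (capacity-lower (p + q) _ h)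

H≤ˡ : ∀ p q → H p q ≤ p
H≤ˡ p q = ≤-trans (m⊓n≤m (p ⊓ q) _) (m⊓n≤m p q)

H≤ʳ : ∀ p q → H p q ≤ q
H≤ʳ p q = ≤-trans (m⊓n≤m (p ⊓ q) _) (m⊓n≤n p q)

H-upper : ∀ p q → 1 ≤ p + q → 5 * H p q + 2 ≤ 2 * (p + q) ⊎ (H p q ≡ 1 × p + q ≡ 3)
H-upper p q 1≤ with capacity-upper (p + q) 1≤
... | inj₁ h = inj₁ (≤-trans (+-monoˡ-≤ 2 (*-monoʳ-≤ 5 (m⊓n≤n (p ⊓ q) (capacity (p + q))))) h)
... | inj₂ s≡3 with H p q | ≤-trans (m⊓n≤n (p ⊓ q) (capacity (p + q))) (≤-reflexive (cong capacity s≡3))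
...   | 0 | _ = inj₁ (subst (λ s → 2 ≤ 2 * s) (sym s≡3) (m≤m+n 2 4))
...   | 1 | _ = inj₂ (refl , s≡3)
...   | suc (suc _) | s≤s ()

-- The exceptional value 1 at total 3 misses the linear bound by one, 7 against 6; an error of 1
-- covers it.
H-upper′ : ∀ p q → 1 ≤ p + q → 5 * H p q + 2 ≤ 2 * (p + q) + 1
H-upper′ p q 1≤ with H-upper p q 1≤
... | inj₁ h = m≤n⇒m≤n+o 1 h
... | inj₂ (H≡1 , s≡3) rewrite H≡1 | s≡3 = ≤-refl

H-comm : ∀ p q → H p q ≡ H q p
H-comm p q = cong₂ _⊓_ (⊓-comm p q) (cong capacity (+-comm p q))

-- A further tip adds 2 to `2 * (p + q)`, more than the error 1 in `H-upper′`.
H-monoˡ : ∀ p q → H p q ≤ H (suc p) q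
H-monoˡ zero    q = z≤n
H-monoˡ (suc p) q = H-lower (suc (suc p)) q (m≤n⇒m≤1+n (H≤ˡ (suc p) q)) (H≤ʳ (suc p) q)
  (raise (H (suc p) q) (H-upper′ (suc p) q (s≤s z≤n)))
  where
  raise : ∀ x → 5 * x + 2 ≤ 2 * (suc p + q) + 1 → 5 * x + 2 ≤ 2 * (suc (suc p) + q)
  raise x h = farkas 0 1 h (solve (x ∷ p ∷ q ∷ []))

H-monoʳ : ∀ p q → H p q ≤ H p (suc q)
H-monoʳ p q = subst₂ _≤_ (H-comm q p) (H-comm (suc q) p) (H-monoˡ q p)

-- Two tips contribute 4 to `2 * (p + q)`; with the error 1 of `H-upper′` this is 5, the price of
-- one unit of `H`.
H-diagonal-step : ∀ p q → H (suc p) (suc q) ≤ suc (H p q)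
H-diagonal-step p q with H (suc p) (suc q) | H≤ˡ (suc p) (suc q) | H≤ʳ (suc p) (suc q)
                       | H-upper′ (suc p) (suc q) (s≤s z≤n)
... | zero  | _      | _      | _ = z≤n
... | suc x | s≤s x≤p | s≤s x≤q | h = s≤s (H-lower p q x≤p x≤q (lower h))
  where
  lower : 5 * suc x + 2 ≤ 2 * (suc p + suc q) + 1 → 5 * x + 2 ≤ 2 * (p + q)
  lower h = farkas 0 0 h (solve (x ∷ p ∷ q ∷ []))

H-stepˡ : ∀ p q → H (suc p) q ≤ suc (H p q)
H-stepˡ p zero    = ≤-trans (H≤ʳ (suc p) zero) z≤n
H-stepˡ p (suc q) = ≤-trans (H-diagonal-step p q) (s≤s (H-monoʳ p q))

≢⇒1≤+ : ∀ {m n} → m ≢ n → 1 ≤ m + n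
≢⇒1≤+ {zero}  {zero}  m≢n = contradiction refl m≢n
≢⇒1≤+ {zero}  {suc n} _   = s≤s z≤n
≢⇒1≤+ {suc m}         _   = s≤s z≤n

-- The extra unit costs 5, one of the two constants 2 is saved, and an exceptional part costs 1. In
-- all this is 4, which is what the two tips used up by a chord contribute.
H-superadditive : ∀ a b c d → a ≢ b → c ≢ d → H a b ⊕ H c d < H (suc (a + c)) (suc (b + d))
H-superadditive a b c d a≢b c≢d with H-upper a b (≢⇒1≤+ a≢b) | H-upper c d (≢⇒1≤+ c≢d)
-- With two exceptional parts, ordinary addition would need `17 ≤ 16`; but `1 ⊕ 1` is 0, so only
-- `H ≥ 1` is required.
... | inj₂ (x≡1 , ab≡3) | inj₂ (y≡1 , cd≡3) rewrite x≡1 | y≡1 =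
  H-lower _ _ (s≤s z≤n) (s≤s z≤n) (bound (≤-reflexive (sym ab≡3)))
  where
  bound : 3 ≤ a + b → 7 ≤ 2 * (suc (a + c) + suc (b + d))
  bound h = farkas 0 (3 + 2 * (c + d)) (2 ⊠ h) (solve (a ∷ b ∷ c ∷ d ∷ []))
... | inj₁ h | _ = ≤-trans (s≤s (⊕≤+ (H a b) (H c d))) (H-lower _ _
  (s≤s (H≤ˡ a b ⊞ H≤ˡ c d)) (s≤s (H≤ʳ a b ⊞ H≤ʳ c d))
  (bound (H a b) (H c d) h (H-upper′ c d (≢⇒1≤+ c≢d))))
  where
  bound : ∀ x y → 5 * x + 2 ≤ 2 * (a + b) → 5 * y + 2 ≤ 2 * (c + d) + 1 →
          5 * suc (x + y) + 2 ≤ 2 * (suc (a + c) + suc (b + d))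
  bound x y h g = farkas 0 0 (h ⊞ g) (solve (x ∷ y ∷ a ∷ b ∷ c ∷ d ∷ []))
... | inj₂ _ | inj₁ h = ≤-trans (s≤s (⊕≤+ (H a b) (H c d))) (H-lower _ _
  (s≤s (H≤ˡ a b ⊞ H≤ˡ c d)) (s≤s (H≤ʳ a b ⊞ H≤ʳ c d))
  (bound (H a b) (H c d) (H-upper′ a b (≢⇒1≤+ a≢b)) h))
  where
  bound : ∀ x y → 5 * x + 2 ≤ 2 * (a + b) + 1 → 5 * y + 2 ≤ 2 * (c + d) →
          5 * suc (x + y) + 2 ≤ 2 * (suc (a + c) + suc (b + d))
  bound x y h g = farkas 0 0 (h ⊞ g) (solve (x ∷ y ∷ a ∷ b ∷ c ∷ d ∷ []))

-- Closed form of `H` in the two off-diagonal cases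

half-bounds : ∀ n → n / 2 * 2 ≤ n × n ≤ suc (n / 2 * 2)
half-bounds n = m/n*n≤m n 2 ,
  ≤-trans (≤-reflexive (m≡m%n+[m/n]*n n 2)) (+-monoˡ-≤ (n / 2 * 2) (s≤s⁻¹ (m%n<n n 2)))

-- On 1, ..., 5 the quotient `i / 4` equals `⌊2(i-1)/5⌋`, and the two bounds express this.
quarter-bounds : ∀ i → 1 ≤ i → i ≤ 5 → 5 * (i / 4) + 2 ≤ 2 * i × 2 * i ≤ 5 * (i / 4) + 6
quarter-bounds 1 _ _ = m≤m+n 2 0 , m≤m+n 2 4
quarter-bounds 2 _ _ = m≤m+n 2 2 , m≤m+n 4 2
quarter-bounds 3 _ _ = m≤m+n 2 4 , m≤m+n 6 0
quarter-bounds 4 _ _ = m≤m+n 7 1 , m≤m+n 8 3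
quarter-bounds 5 _ _ = m≤m+n 7 3 , m≤m+n 10 1
quarter-bounds (suc (suc (suc (suc (suc (suc i)))))) _ (s≤s (s≤s (s≤s (s≤s (s≤s ())))))

-- For `p + q = i + 5m` the floor `⌊2(p+q-1)/5⌋` is `2m + ⌊2(i-1)/5⌋`. The last hypothesis makes it
-- at most `p`, so it is the minimum.
H-balanced : ∀ p q m i → p < q → 1 ≤ i → i ≤ 5 → p + q ≡ i + m * 5 →
             q + ∣ p - 2 ∣ / 2 < 2 * p → H p q ≡ 2 * m + i / 4
H-balanced 0 q m i _ _ _ _ ()
H-balanced 1 q m i 1<q _ _ _ h = contradiction (≤-trans 1<q (≤-trans (m≤m+n q 0) (s≤s⁻¹ h))) λ { (s≤s ()) }
H-balanced p@(suc (suc n)) q m i p<q 1≤i i≤5 s≡ h =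
  ≤-antisym upper (H-lower p q x≤p (≤-trans x≤p (<⇒≤ p<q)) lower)
  where
  above : ∀ s f → s ≡ i + m * 5 → 5 * f + 2 ≤ 2 * i → 5 * (2 * m + f) + 2 ≤ 2 * s
  above s f eq h = farkas 0 0 (h ⊞ 2 ⊠ ≤-reflexive (sym eq)) (solve (m ∷ f ∷ i ∷ s ∷ []))
  lower : 5 * (2 * m + i / 4) + 2 ≤ 2 * (p + q)
  lower = above (p + q) (i / 4) s≡ (proj₁ (quarter-bounds i 1≤i i≤5))
  below-p : ∀ x e p → 5 * x + 2 ≤ 2 * (p + q) → q + e < 2 * p → p ≤ 3 + e * 2 → x ≤ p
  below-p x e p h₁ h₂ h₃ = farkas 4 5 (h₁ ⊞ 2 ⊠ h₂ ⊞ h₃) (solve (x ∷ e ∷ p ∷ q ∷ []))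
  x≤p : 2 * m + i / 4 ≤ p
  x≤p = below-p (2 * m + i / 4) (n / 2) p lower (subst (λ d → q + d / 2 < 2 * p) (∣-∣-identityʳ n) h)
    (s≤s (s≤s (proj₂ (half-bounds n))))
  regular : ∀ x s f → s ≡ i + m * 5 → 5 * x + 2 ≤ 2 * s → 2 * i ≤ 5 * f + 6 → x ≤ 2 * m + f
  regular x s f eq h₁ h₂ = farkas 4 0 (h₁ ⊞ 2 ⊠ ≤-reflexive eq ⊞ h₂) (solve (x ∷ m ∷ f ∷ i ∷ s ∷ []))
  upper : H p q ≤ 2 * m + i / 4
  upper with H-upper p q (s≤s z≤n)
  ... | inj₁ g = regular (H p q) (p + q) (i / 4) s≡ g (proj₂ (quarter-bounds i 1≤i i≤5))
  ... | inj₂ (_ , s≡3) = contradiction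
    (≤-trans (s≤s (s≤s (m≤n⇒m≤o+n n (≤-trans (s≤s (s≤s (s≤s z≤n))) p<q)))) (≤-reflexive s≡3))
    λ { (s≤s (s≤s (s≤s ()))) }

-- For `p ≥ 2` and `e = (p - 2) / 2`, the bounds `q ≥ 2p - e` and `2e ≤ p - 2` give
-- `2(p+q) ≥ 5p + 2`, so the capacity is at least `p`.
H-unbalanced : ∀ p q → p < q → 2 * p ≤ q + ∣ p - 2 ∣ / 2 → H p q ≡ p
H-unbalanced 0 q _ _ = refl
-- The exceptional value meets the theorem here: the floor formula would give 0 instead of 1.
H-unbalanced 1 2 _ _ = refl
H-unbalanced 1 1 (s≤s ()) _
H-unbalanced 1 (suc (suc (suc q))) _ _ = ≤-antisym (H≤ˡ 1 (3 + q))
  (H-lower 1 (3 + q) ≤-refl (s≤s z≤n) (farkas 0 (1 + 2 * q) z≤n (solve (q ∷ []))))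
H-unbalanced (suc (suc n)) q p<q h = ≤-antisym (H≤ˡ (2 + n) q)
  (H-lower (2 + n) q ≤-refl (<⇒≤ p<q) bound)
  where
  bound′ : ∀ e p → 2 * p ≤ q + e → 2 + e * 2 ≤ p → 5 * p + 2 ≤ 2 * (p + q)
  bound′ e p h₁ h₂ = farkas 0 0 (2 ⊠ h₁ ⊞ h₂) (solve (e ∷ p ∷ q ∷ []))
  bound : 5 * (2 + n) + 2 ≤ 2 * (2 + n + q)
  bound = bound′ (n / 2) (2 + n) (subst (λ d → 2 * (2 + n) ≤ q + d / 2) (∣-∣-identityʳ n) h)
    (s≤s (s≤s (proj₁ (half-bounds n))))

-- The game on region types

-- Types of regions: square p q is a 4-cycle with p and q tips at two opposite
-- corners and one tip at each of the others; digon n carries n tips at one vertex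
-- and one at a nonadjacent vertex; dead is the same for adjacent vertices.
data Shape : Set where
  square : ℕ → ℕ → Shape
  digon  : ℕ → Shape
  dead   : Shape

-- The crossbar of a `chord` supplies the missing single-tip corner of either part; after `cross` it
-- is the single tip of both parts; after `fold` it is adjacent to the other corner, which kills
-- both parts.
data Split : Shape → Shape → Shape → Set where
  chord : ∀ {p q} a b c d → p ≡ suc (a + c) → q ≡ suc (b + d) →
          Split (square p q) (square a b) (square c d)
  cross : ∀ {p q} → Split (square p q) (digon q) (digon p)
  fold  : ∀ {n m} → n ≡ suc m → Split (digon n) dead dead

grundy : Shape → ℕ
grundy (square p q)    = if does (p ≟ q) then 1 else false ∷₂ H p q
grundy (digon zero)    = 0
grundy (digon (suc _)) = 1
grundy dead            = 0

grundy-diagonal : ∀ {p q} → p ≡ q → grundy (square p q) ≡ 1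
grundy-diagonal {p} {q} p≡q rewrite dec-true (p ≟ q) p≡q = refl

grundy-off-diagonal : ∀ {p q} → p ≢ q → grundy (square p q) ≡ false ∷₂ H p q
grundy-off-diagonal {p} {q} p≢q rewrite dec-false (p ≟ q) p≢q = refl

∷₂-injectiveˡ : ∀ {i j} m n → i ∷₂ m ≡ j ∷₂ n → i ≡ j
∷₂-injectiveˡ {i} {j} m n eq = trans (sym (odd-∷₂ i m)) (trans (cong odd eq) (odd-∷₂ j n))

∷₂-injectiveʳ : ∀ i j {m n} → i ∷₂ m ≡ j ∷₂ n → m ≡ n
∷₂-injectiveʳ i j {m} {n} eq = trans (sym (half-∷₂ i m)) (trans (cong ⌊_/2⌋ eq) (half-∷₂ j n))

-- The option `cross` has value `1 ⊕ 1 = 0` when both corners carry tips, so the value of the square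
-- must not vanish. The pair 1, 2 depends on the exceptional value.
H-positive : ∀ p q → p ≢ q → 1 ≤ p → 1 ≤ q → 1 ≤ H p q
H-positive 1 1 p≢q _ _ = contradiction refl p≢q
H-positive 1 2 _ _ _ = s≤s z≤n
H-positive 2 1 _ _ _ = s≤s z≤n
H-positive 1 (suc (suc (suc q))) _ h g = H-lower 1 (3 + q) h g (farkas 0 (1 + 2 * q) z≤n (solve (q ∷ [])))
H-positive (suc (suc (suc p))) 1 _ h g = H-lower (3 + p) 1 h g (farkas 0 (1 + 2 * p) z≤n (solve (p ∷ [])))
H-positive (suc (suc p)) (suc (suc q)) _ h g =
  H-lower (2 + p) (2 + q) h g (farkas 0 (1 + 2 * p + 2 * q) z≤n (solve (p ∷ q ∷ [])))

grundy-sum : ∀ s t i j {m n} → grundy s ≡ i ∷₂ m → grundy t ≡ j ∷₂ n →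
             grundy s ⊕ grundy t ≡ (i xor j) ∷₂ (m ⊕ n)
grundy-sum s t i j {m} {n} eq₁ eq₂ = trans (cong₂ _⊕_ eq₁ eq₂) (⊕-∷₂ i m j n)

-- Diagonal squares have value 1 and all others an even value. Parity settles a chord except in two
-- cases: three diagonal squares, where the option is 0, and three off-diagonal ones, where
-- `H-superadditive` decides.
split-avoids : ∀ {s s₁ s₂} → Split s s₁ s₂ → grundy s₁ ⊕ grundy s₂ ≢ grundy s
split-avoids (chord a b c d refl refl) eq with suc (a + c) ≟ suc (b + d) | a ≟ b | c ≟ d
... | yes p≡q | yes a≡b | yes c≡d = contradiction
  (trans (sym (grundy-sum (square a b) (square c d) true true {0} {0}
      (grundy-diagonal a≡b) (grundy-diagonal c≡d)))
    (trans eq (grundy-diagonal p≡q))) λ ()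
... | yes p≡q | no a≢b | yes c≡d =
  contradiction (+-cancelʳ-≡ c a b (trans (suc-injective p≡q) (cong (b +_) (sym c≡d)))) a≢b
... | yes p≡q | yes a≡b | no c≢d =
  contradiction (+-cancelˡ-≡ a c d (trans (suc-injective p≡q) (cong (_+ d) (sym a≡b)))) c≢d
... | yes p≡q | no a≢b | no c≢d = contradiction
  (∷₂-injectiveˡ {false} {true} (H a b ⊕ H c d) 0
    (trans (sym (grundy-sum (square a b) (square c d) false false {H a b} {H c d}
        (grundy-off-diagonal a≢b) (grundy-off-diagonal c≢d)))
      (trans eq (grundy-diagonal p≡q)))) λ ()
... | no p≢q | yes a≡b | yes c≡d = contradiction (cong suc (cong₂ _+_ a≡b c≡d)) p≢q
... | no p≢q | yes a≡b | no c≢d = contradiction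
  (∷₂-injectiveˡ {true} {false} (0 ⊕ H c d) (H (suc (a + c)) (suc (b + d)))
    (trans (sym (grundy-sum (square a b) (square c d) true false {0} {H c d}
        (grundy-diagonal a≡b) (grundy-off-diagonal c≢d)))
      (trans eq (grundy-off-diagonal p≢q)))) λ ()
... | no p≢q | no a≢b | yes c≡d = contradiction
  (∷₂-injectiveˡ {true} {false} (H a b ⊕ 0) (H (suc (a + c)) (suc (b + d)))
    (trans (sym (grundy-sum (square a b) (square c d) false true {H a b} {0}
        (grundy-off-diagonal a≢b) (grundy-diagonal c≡d)))
      (trans eq (grundy-off-diagonal p≢q)))) λ ()
... | no p≢q | no a≢b | no c≢d =
  <⇒≢ (H-superadditive a b c d a≢b c≢d) (∷₂-injectiveʳ false false
    (trans (sym (grundy-sum (square a b) (square c d) false false {H a b} {H c d}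
        (grundy-off-diagonal a≢b) (grundy-off-diagonal c≢d)))
      (trans eq (grundy-off-diagonal p≢q))))
split-avoids (cross {zero}  {zero})  = λ ()
split-avoids (cross {zero}  {suc q}) = λ ()
split-avoids (cross {suc p} {zero})  = λ ()
split-avoids (cross {suc p} {suc q}) eq with suc p ≟ suc q
... | yes p≡q = contradiction (trans eq (grundy-diagonal p≡q)) λ ()
... | no  p≢q = <⇒≢ (H-positive _ _ p≢q (s≤s z≤n) (s≤s z≤n))
  (∷₂-injectiveʳ false false (trans eq (grundy-off-diagonal p≢q)))
split-avoids (fold refl) = λ ()

-- Values of the options of a region

Attains : Shape → ℕ → Set
Attains s k = ∃[ s₁ ] ∃[ s₂ ] (Split s s₁ s₂ × grundy s₁ ⊕ grundy s₂ ≡ k)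

attains-swap : ∀ {p q k} → Attains (square p q) k → Attains (square q p) k
attains-swap (_ , _ , chord a b c d p≡ q≡ , eq) =
  -, -, chord b a d c q≡ p≡ , trans (cong₂ _⊕_ (symmetric b a) (symmetric d c)) eq
  where
  symmetric : ∀ p q → grundy (square p q) ≡ grundy (square q p)
  symmetric p q with p ≟ q
  ... | yes p≡q = trans (grundy-diagonal p≡q) (sym (grundy-diagonal (sym p≡q)))
  ... | no  p≢q = trans (grundy-off-diagonal p≢q)
    (trans (cong (false ∷₂_) (H-comm p q)) (sym (grundy-off-diagonal (p≢q ∘ sym))))
attains-swap {p} {q} (_ , _ , cross , eq) =
  -, -, cross , trans (⊕-comm (grundy (digon p)) (grundy (digon q))) eq

attains-even : ∀ {p q j} a b c d → a ≢ b → c ≢ d → p ≡ suc (a + c) → q ≡ suc (b + d) →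
               H a b ⊕ H c d ≡ j → Attains (square p q) (false ∷₂ j)
attains-even a b c d a≢b c≢d p≡ q≡ eq = -, -, chord a b c d p≡ q≡ ,
  trans (grundy-sum (square a b) (square c d) false false {H a b} {H c d}
      (grundy-off-diagonal a≢b) (grundy-off-diagonal c≢d))
    (cong (false ∷₂_) eq)

discrete-ivt : (F : ℕ → ℕ) → F 0 ≡ 0 → (∀ i → F (suc i) ≤ suc (F i)) →
               ∀ n {j} → j < F n → ∃[ i ] (i < n × F i ≡ j)
discrete-ivt F F0≡0 step zero {j} j<F0 = contradiction (subst (j <_) F0≡0 j<F0) λ ()
discrete-ivt F F0≡0 step (suc n) {j} j<F with m≤n⇒m<n∨m≡n (s≤s⁻¹ (≤-trans j<F (step n)))
... | inj₂ j≡Fn = n , ≤-refl , sym j≡Fn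
... | inj₁ j<Fn with discrete-ivt F F0≡0 step n j<Fn
...   | i , i<n , Fi≡j = i , m≤n⇒m≤1+n i<n , Fi≡j

-- A diagonal part `a, a` contributes 1. The other part runs along the line `i, i + 1 + e` with
-- `e = q - p - 1`, on which `H` starts at 0, rises by at most 1 per step and reaches `H p q` at
-- `i = p`.
attains-odd : ∀ {p q j} → p < q → j < H p q → Attains (square p q) (true ∷₂ j)
attains-odd {p} {q} {j} p<q j<H with m≤n⇒∃[o]m+o≡n p<q
... | e , refl with discrete-ivt (λ i → H i (suc i + e)) refl (λ i → H-diagonal-step i (suc i + e)) p j<H
...   | i , i<p , Hi≡j with m≤n⇒∃[o]m+o≡n i<p
...     | a , refl = -, -, chord a a i (suc i + e) (cong suc (+-comm i a)) (cong suc (rearrange i a e)) ,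
  trans (grundy-sum (square a a) (square i (suc i + e)) true false {0} {H i (suc i + e)}
      (grundy-diagonal {a} refl) (grundy-off-diagonal (<⇒≢ (s≤s (m≤m+n i e)))))
    (cong (true ∷₂_) (trans (⊕-identityˡ _) Hi≡j))
  where
  rearrange : ∀ i a e → suc (i + a + e) ≡ a + suc (i + e)
  rearrange = solve-∀

-- The two cases in which an even value is not found among the sums
-- H (suc c) 0 ⊕ H i (q - 1).
attains-loose : ∀ p q j → p < q → 1 ≤ j → j ≤ p → H p q ≤ j → 5 * j + 8 ≤ 2 * (suc p + suc q) →
                Attains (square (suc p) (suc q)) (false ∷₂ j)
attains-loose p (suc q) j (s≤s p≤q) 1≤j j≤p H≤j h with p ≟ q
-- The part `0, 1` has value 0; monotonicity and the available room squeeze `H p q` to `j`.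
... | no p≢q = attains-even 0 1 p q (λ ()) p≢q refl refl (trans (⊕-identityˡ _)
  (≤-antisym (≤-trans (H-monoʳ p q) H≤j) (H-lower p q j≤p (≤-trans j≤p p≤q) bound)))
  where
  bound : 5 * j + 2 ≤ 2 * (p + q)
  bound = farkas 0 0 h (solve (j ∷ p ∷ q ∷ []))
attains-loose zero q j _ 1≤j j≤0 _ _ | yes refl = contradiction (≤-trans 1≤j j≤0) λ ()
-- The part left over by `0, 1` would be diagonal, so `1, 0` is split off instead.
attains-loose (suc p) _ j _ 1≤j j≤p H≤j h | yes refl =
  attains-even 1 0 p (2 + p) (λ ()) (<⇒≢ (s≤s (n≤1+n p))) refl refl (trans (⊕-identityˡ _)
    (≤-antisym (≤-trans (H-monoˡ p (2 + p)) H≤j) (H-lower p (2 + p) j≤p′ (≤-trans j≤p′ (m≤n+m p 2)) bound)))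
  where
  j≤p′ : j ≤ p
  j≤p′ = farkas 4 (p + 2) h (solve (j ∷ p ∷ []))
  bound : 5 * j + 2 ≤ 2 * (p + (2 + p))
  bound = farkas 0 0 h (solve (j ∷ p ∷ []))

-- Here the exceptional value H 1 2 ≡ 1 is needed.
attains-tight : ∀ p q j → p < q → 1 ≤ j → j ≤ p → 5 * j + 7 ≡ 2 * (suc p + suc q) →
                Attains (square (suc p) (suc q)) (false ∷₂ j)
attains-tight zero q j _ 1≤j j≤0 _ = contradiction (≤-trans 1≤j j≤0) λ ()
attains-tight (suc p) (suc zero) j (s≤s ()) _ _ _
attains-tight (suc p) (suc (suc q)) j (s≤s (s≤s p≤q)) 1≤j j≤p eq
  with odd j | ⌊ j /2⌋ | ∷₂-odd-half j
-- The equation makes `5 * j + 7` even, so `j` is odd.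
... | false | t | refl = contradiction
  (∷₂-injectiveˡ {true} {false} (5 * t + 3) (suc (suc p) + suc (suc (suc q)))
    (trans (lhs t) (trans eq (rhs p q)))) λ ()
  where
  lhs : ∀ t → suc ((5 * t + 3) + (5 * t + 3)) ≡ 5 * (t + t) + 7
  lhs = solve-∀
  rhs : ∀ p q → 2 * (suc (suc p) + suc (suc (suc q))) ≡
                (suc (suc p) + suc (suc (suc q))) + (suc (suc p) + suc (suc (suc q)))
  rhs = solve-∀
... | true | t | refl with p ≟ q
-- The part `1, 2` supplies the last binary digit of `j`; the other part has `H p q = 2t`.
...   | no p≢q = attains-even 1 2 p q (λ ()) p≢q refl refl
  (trans (cong (1 ⊕_) (≤-antisym (above (H p q) (H-upper′ p q (≢⇒1≤+ p≢q)))
                                 (H-lower p q (s≤s⁻¹ j≤p) (≤-trans (s≤s⁻¹ j≤p) p≤q) below)))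
         (trans (⊕-∷₂ true 0 false t) (cong (true ∷₂_) (⊕-identityˡ t))))
  where
  below : 5 * (t + t) + 2 ≤ 2 * (p + q)
  below = farkas 0 0 (≤-reflexive eq) (solve (t ∷ p ∷ q ∷ []))
  above : ∀ x → 5 * x + 2 ≤ 2 * (p + q) + 1 → x ≤ t + t
  above x h = farkas 4 3 (h ⊞ ≤-reflexive (sym eq)) (solve (x ∷ t ∷ p ∷ q ∷ []))
attains-tight (suc zero) _ _ _ _ _ eq | true | t | refl | yes refl = contradiction absurd λ ()
  where
  absurd : 1 ≤ 0
  absurd = farkas 0 (1 + 10 * t) (≤-reflexive eq) (solve (t ∷ []))
attains-tight (suc (suc p)) _ _ _ _ _ eq | true | zero | refl | yes refl = contradiction absurd λ ()
  where
  absurd : 1 ≤ 0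
  absurd = farkas 0 (1 + 4 * p) (≤-reflexive (sym eq)) (solve (p ∷ []))
-- The complement of `1, 2` would be diagonal; `2, 1` leaves `p, 2 + p` with the same total.
attains-tight (suc (suc p)) _ _ _ _ j≤p eq | true | t@(suc t′) | refl | yes refl =
  attains-even 2 1 p (2 + p) (λ ()) (<⇒≢ (s≤s (n≤1+n p))) refl refl
    (trans (cong (1 ⊕_) (≤-antisym (above (H p (2 + p)) (H-upper′ p (2 + p) (≢⇒1≤+ (<⇒≢ (s≤s (n≤1+n p))))))
                                   (H-lower p (2 + p) small (≤-trans small (m≤n+m p 2)) below)))
           (trans (⊕-∷₂ true 0 false t) (cong (true ∷₂_) (⊕-identityˡ t))))
  where
  small : t + t ≤ p
  small = farkas 3 (2 * t′ + 3) (≤-reflexive eq) (solve (t′ ∷ p ∷ []))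
  below : 5 * (t + t) + 2 ≤ 2 * (p + (2 + p))
  below = farkas 0 0 (≤-reflexive eq) (solve (t′ ∷ p ∷ []))
  above : ∀ x → 5 * x + 2 ≤ 2 * (p + (2 + p)) + 1 → x ≤ t + t
  above x h = farkas 4 3 (h ⊞ ≤-reflexive (sym eq)) (solve (x ∷ t′ ∷ p ∷ []))

attains-below : ∀ p q j → p < q → j < H p q → Attains (square p q) (false ∷₂ j)
attains-below zero    q       j _         ()
attains-below (suc p) (suc q) zero _ _ = -, -, cross , refl
attains-below (suc p) (suc q) j@(suc _) (s≤s p<q) j<H with <-≤-connex j (H p q)
-- The companion part `suc c, 0` has value 0, so the chord has value `2 * H i q`, with `i` running
-- from 0 towards `p`.
... | inj₁ j<H′ with discrete-ivt (λ i → H i q) refl (λ i → H-stepˡ i q) p j<H′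
...   | i , i<p , Hi≡j with m≤n⇒∃[o]m+o≡n i<p
...     | c , refl = attains-even i q (suc c) 0 (<⇒≢ (<-trans i<p p<q)) (λ ())
  (cong suc (sym (+-suc i c))) (cong suc (sym (+-identityʳ q)))
  (trans (⊕-identityʳ _) Hi≡j)
-- Now `H p q ≤ j < H (suc p) (suc q)`. Outside the exceptional total this gives
-- `5 * j + 7 ≤ 2 * (suc p + suc q)`, and strictness separates the two remaining cases.
attains-below (suc p) (suc q) j@(suc j′) (s≤s p<q) j<H | inj₂ H≤j
  with H-upper (suc p) (suc q) (s≤s z≤n)
... | inj₂ (H≡1 , _) = contradiction (subst (j <_) H≡1 j<H) λ { (s≤s ()) }
... | inj₁ upper with m≤n⇒m<n∨m≡n (room (H (suc p) (suc q)) j<H upper)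
  where
  room : ∀ x → suc j ≤ x → 5 * x + 2 ≤ 2 * (suc p + suc q) → 5 * j + 7 ≤ 2 * (suc p + suc q)
  room x h g = farkas 0 0 (5 ⊠ h ⊞ g) (solve (j′ ∷ x ∷ p ∷ q ∷ []))
...   | inj₁ loose = attains-loose p q j p<q (s≤s z≤n) (s≤s⁻¹ (≤-trans j<H (H≤ˡ (suc p) (suc q)))) H≤j
  (subst (_≤ 2 * (suc p + suc q)) (sym (+-suc (5 * j) 7)) loose)
...   | inj₂ tight = attains-tight p q j p<q (s≤s z≤n) (s≤s⁻¹ (≤-trans j<H (H≤ˡ (suc p) (suc q)))) tight

attains-< : ∀ {p q} → p < q → ∀ k → k < false ∷₂ H p q → Attains (square p q) k
attains-< {p} {q} p<q k k< with odd k | ⌊ k /2⌋ | ∷₂-odd-half k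
... | i | j | refl with ∷₂-<-cases i false {j} {H p q} k<
attains-< p<q _ k< | true  | j | refl | inj₁ j<H = attains-odd p<q j<H
attains-< p<q _ k< | false | j | refl | inj₁ j<H = attains-below _ _ j p<q j<H

split-attains : ∀ s k → k < grundy s → Attains s k
split-attains (digon (suc n)) zero _ = -, -, fold refl , refl
split-attains (digon (suc n)) (suc k) (s≤s ())
split-attains (square p q) k k< with <-cmp p q
... | tri< p<q p≢q _ = attains-< p<q k (subst (k <_) (grundy-off-diagonal p≢q) k<)
... | tri> _ p≢q q<p = attains-swap (attains-< q<p k
  (subst (k <_) (trans (grundy-off-diagonal p≢q) (cong (false ∷₂_) (H-comm p q))) k<))
split-attains (square zero    .zero)    k k< | tri≈ _ refl _ = -, -, cross , sym (n<1⇒n≡0 k<)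
split-attains (square (suc p) .(suc p)) k k< | tri≈ _ refl _ = -, -, cross ,
  sym (n<1⇒n≡0 (subst (k <_) (grundy-diagonal {suc p} refl) k<))

-- Disjunctive sums of regions

infix 4 _⇒_
data _⇒_ : List Shape → List Shape → Set where
  here  : ∀ {s s₁ s₂ ss} → Split s s₁ s₂ → s ∷ ss ⇒ s₁ ∷ s₂ ∷ ss
  there : ∀ {s ss ss′} → ss ⇒ ss′ → s ∷ ss ⇒ s ∷ ss′

nimValue : List Shape → ℕ
nimValue []       = 0
nimValue (s ∷ ss) = grundy s ⊕ nimValue ss

-- A move keeps the number of tips and adds a region, so tips minus one, summed over regions,
-- decreases. Dead regions have no moves and count 0.
weight : Shape → ℕ
weight (square p q) = suc (p + q)
weight (digon n)    = n
weight dead         = 0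

totalWeight : List Shape → ℕ
totalWeight []       = 0
totalWeight (s ∷ ss) = weight s + totalWeight ss

split-weight : ∀ {s s₁ s₂} → Split s s₁ s₂ → weight s₁ + weight s₂ < weight s
split-weight (chord a b c d refl refl) = ≤-reflexive (regroup a b c d)
  where
  regroup : ∀ a b c d → suc (suc (a + b) + suc (c + d)) ≡ suc (suc (a + c) + suc (b + d))
  regroup = solve-∀
split-weight (cross {p} {q}) = ≤-reflexive (cong suc (+-comm q p))
split-weight (fold refl)  = s≤s z≤n

⇒-weight : ∀ {ss ss′} → ss ⇒ ss′ → totalWeight ss′ < totalWeight ss
⇒-weight (here {s} {s₁} {s₂} {ss} split) =
  subst (_< weight s + totalWeight ss) (+-assoc (weight s₁) (weight s₂) (totalWeight ss))
    (+-monoˡ-< (totalWeight ss) (split-weight split))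
⇒-weight (there {s} move) = +-monoʳ-< (weight s) (⇒-weight move)

⇒-avoids : ∀ {ss ss′} → ss ⇒ ss′ → nimValue ss′ ≢ nimValue ss
⇒-avoids (here {s₁ = s₁} {s₂} {ss} split) eq = split-avoids split
  (⊕-cancelʳ (nimValue ss) (trans (⊕-assoc (grundy s₁) (grundy s₂) (nimValue ss)) eq))
⇒-avoids (there {s} move) eq = ⇒-avoids move (⊕-cancelˡ (grundy s) eq)

-- The Sprague-Grundy argument: `⊕-reduce` selects a summand to lower, and a move in it alone does
-- so.
⇒-attains : ∀ ss k → k < nimValue ss → ∃[ ss′ ] (ss ⇒ ss′ × nimValue ss′ ≡ k)
⇒-attains (s ∷ ss) k k< with ⊕-reduce (grundy s) (nimValue ss) k k<
... | inj₂ (v , v< , eq) with ⇒-attains ss v v<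
...   | ss′ , move , refl = s ∷ ss′ , there move , eq
⇒-attains (s ∷ ss) k k< | inj₁ (g , g< , eq) with split-attains s g g<
... | s₁ , s₂ , split , refl = s₁ ∷ s₂ ∷ ss , here split ,
  trans (sym (⊕-assoc (grundy s₁) (grundy s₂) (nimValue ss))) eq

shapes-nimber : ∀ ss → Nimber _⇒_ ss (nimValue ss)
shapes-nimber ss = go ss (<-wellFounded (totalWeight ss))
  where
  go : ∀ ss → Acc _<_ (totalWeight ss) → Nimber _⇒_ ss (nimValue ss)
  go ss (acc rec) = mex
    (λ k k< → let ss′ , move , eq = ⇒-attains ss k k< in
              ss′ , move , subst (Nimber _⇒_ ss′) eq (go ss′ (rec (⇒-weight move))))
    (λ ss′ move → nimValue ss′ , go ss′ (rec (⇒-weight move)) , ⇒-avoids move)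

-- Induction on the derivation of the nimber of `b`: `back` supplies options of all smaller nimbers,
-- `forth` covers every option of `a`.
Nimber-bisimulation :
  ∀ {A B : Set} {_⟶_ : Rel A 0ℓ} {_⇝_ : Rel B 0ℓ} (_~_ : A → B → Set) →
  (∀ {a b a′} → a ~ b → a ⟶ a′ → ∃[ b′ ] (b ⇝ b′ × a′ ~ b′)) →
  (∀ {a b b′} → a ~ b → b ⇝ b′ → ∃[ a′ ] (a ⟶ a′ × a′ ~ b′)) →
  ∀ {a b k} → a ~ b → Nimber _⇝_ b k → Nimber _⟶_ a k
Nimber-bisimulation _~_ forth back a~b (mex below avoid) = mex
  (λ j j<k → let b′ , b⇝b′ , η = below j j<k
                 a′ , a⟶a′ , a′~b′ = back a~b b⇝b′
             in a′ , a⟶a′ , Nimber-bisimulation _~_ forth back a′~b′ η)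
  (λ a′ a⟶a′ → let b′ , b⇝b′ , a′~b′ = forth a~b a⟶a′
                   j , η , j≢k = avoid b′ b⇝b′
               in j , Nimber-bisimulation _~_ forth back a′~b′ η , j≢k)

-- The ring solver rejects variable lists built with an overloaded _∷_ and terms with
-- an overloaded suc, so the other types with such constructors are opened only now.
open import Data.Fin using (zero; suc)
open import Data.Integer as ℤ using (+_)
import Data.Integer.Properties as ℤ
open import Data.List.Membership.Propositional.Properties using (∈-lookup)
open import Data.List.Relation.Binary.Pointwise as Pointwise using (Pointwise; []; _∷_)
open import Data.List.Relation.Unary.All as All using (All; []; _∷_)
open import Data.List.Relation.Unary.AllPairs using (AllPairs; []; _∷_)
open import Data.List.Relation.Unary.Any as Any using (Any; here; there)
open import Data.List.Relation.Unary.Any.Properties using (lookup-index)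
open import Data.Vec using ([]; _∷_)

-- Drawings

Adjacent : Graph → ℕ → ℕ → Set
Adjacent G u v = Any (λ e → Joins e u v) (edges G)

Adjacent-sym : ∀ {G u v} → Adjacent G u v → Adjacent G v u
Adjacent-sym = Any.map swap

Within : ℕ → ℕ × ℕ → Set
Within n (u , v) = u < n × v < n

Bichromatic : (ℕ → Bool) → ℕ × ℕ → Set
Bichromatic c (u , v) = c u ≢ c v

Parallel : ℕ × ℕ → ℕ × ℕ → Set
Parallel e (u , v) = Joins e u v

-- The invariant of play: two colours exclude odd cycles, `simple` excludes bigons, and `within`
-- makes `order G` a fresh vertex.
record Bipartite (c : ℕ → Bool) (G : Graph) : Set where
  field
    within      : All (Within (order G)) (edges G)
    bichromatic : All (Bichromatic c) (edges G)
    simple      : AllPairs (λ e f → ¬ Parallel e f) (edges G)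

open Bipartite

joins-bichromatic : ∀ {c e u v} → Joins e u v → Bichromatic c e → c u ≢ c v
joins-bichromatic (inj₁ (refl , refl)) cu≢cv = cu≢cv
joins-bichromatic (inj₂ (refl , refl)) cv≢cu = cv≢cu ∘ sym

joins-within : ∀ {n e u v} → Joins e u v → Within n e → u < n × v < n
joins-within (inj₁ (refl , refl)) (u< , v<) = u< , v<
joins-within (inj₂ (refl , refl)) (v< , u<) = u< , v<

joins-parallel : ∀ {e f u v} → Joins e u v → Joins f u v → Parallel e f
joins-parallel (inj₁ (refl , refl)) (inj₁ (refl , refl)) = inj₁ (refl , refl)
joins-parallel (inj₁ (refl , refl)) (inj₂ (refl , refl)) = inj₂ (refl , refl)
joins-parallel (inj₂ (refl , refl)) (inj₁ (refl , refl)) = inj₂ (refl , refl)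
joins-parallel (inj₂ (refl , refl)) (inj₂ (refl , refl)) = inj₁ (refl , refl)

all-lookup : ∀ {A : Set} {P : A → Set} {xs} → All P xs → ∀ i → P (lookup xs i)
all-lookup ps i = All.lookup ps (∈-lookup i)

adjacent-bichromatic : ∀ {c G u v} → Bipartite c G → Adjacent G u v → c u ≢ c v
adjacent-bichromatic B uv =
  joins-bichromatic (lookup-index uv) (all-lookup (bichromatic B) (Any.index uv))

adjacent-within : ∀ {c G u v} → Bipartite c G → Adjacent G u v → u < order G × v < order G
adjacent-within B uv = joins-within (lookup-index uv) (all-lookup (within B) (Any.index uv))

simple-injective : ∀ {es} → AllPairs (λ e f → ¬ Parallel e f) es → ∀ i j {u v} →
                   Joins (lookup es i) u v → Joins (lookup es j) u v → i ≡ j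
simple-injective (_ ∷ _)  zero    zero    _  _  = refl
simple-injective (h ∷ _)  zero    (suc j) eu fu = contradiction (joins-parallel eu fu) (all-lookup h j)
simple-injective (h ∷ _)  (suc i) zero    eu fu = contradiction (joins-parallel fu eu) (all-lookup h i)
simple-injective (_ ∷ hs) (suc i) (suc j) eu fu = cong suc (simple-injective hs i j eu fu)

-- Only lengths 1, 2 and 3 matter: 1 and 3 are odd, and the two edges of a bigon would be parallel.
-- `girth k` treats length `suc k`.
bipartite⇒𝒫₄ : ∀ {c G} → Bipartite c G → 𝒫₄ G
bipartite⇒𝒫₄ {c} {G} B = girth
  where
  coloured : ∀ {k} (C : Cycle G k) i → c (Cycle.vertex C i) ≢ c (Cycle.vertex C (next i))
  coloured C i = joins-bichromatic {c} (Cycle.joins C i) (all-lookup (bichromatic B) (Cycle.edge C i))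
  no-odd-triangle : ∀ {x y z : Bool} → x ≢ y → y ≢ z → z ≢ x → ⊥
  no-odd-triangle x≢y y≢z z≢x = z≢x (trans (¬-not (y≢z ∘ sym)) (sym (¬-not x≢y)))
  girth : 𝒫₄ G
  girth 0 C = contradiction refl (coloured C zero)
  girth 1 C with Cycle.edge-inj C (simple-injective (simple B) (Cycle.edge C zero) (Cycle.edge C (suc zero))
                                     (Cycle.joins C zero) (swap (Cycle.joins C (suc zero))))
  ... | ()
  girth 2 C = contradiction (no-odd-triangle (coloured C zero) (coloured C (suc zero))
                                             (coloured C (suc (suc zero)))) λ ()
  girth (suc (suc (suc k))) _ = s≤s (s≤s (s≤s (s≤s z≤n)))

recolour : ℕ → Bool → (ℕ → Bool) → ℕ → Bool
recolour w b c v = if does (v ≟ w) then b else c v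

recolour-new : ∀ w b c → recolour w b c w ≡ b
recolour-new w b c rewrite dec-true (w ≟ w) refl = refl

recolour-old : ∀ {w} b c {v} → v < w → recolour w b c v ≡ c v
recolour-old {w} b c {v} v<w rewrite dec-false (v ≟ w) (<⇒≢ v<w) = refl

-- The curve is a path of length two between equally coloured vertices, so its midpoint gets the
-- other colour. Its halves are not parallel as `u ≢ v`, nor parallel to old edges as the midpoint
-- is fresh.
addCurve-bipartite : ∀ {c G u v} → Bipartite c G → u < order G → v < order G → u ≢ v → c u ≡ c v →
                     Bipartite (recolour (order G) (not (c u)) c) (addCurve u v G)
addCurve-bipartite {c} {G} {u} {v} B u<w v<w u≢v cu≡cv = record
  { within      = (m<n⇒m<1+n u<w , ≤-refl) ∷ (≤-refl , m<n⇒m<1+n v<w) ∷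
                  All.map (λ (x< , y<) → m<n⇒m<1+n x< , m<n⇒m<1+n y<) (within B)
  ; bichromatic = (λ eq → not-¬ refl (trans (sym (old u<w)) (trans eq new))) ∷
                  (λ eq → not-¬ (sym cu≡cv) (trans (sym (old v<w)) (trans (sym eq) new))) ∷
                  All.zipWith (λ ((x< , y<) , cx≢cy) eq → cx≢cy (trans (sym (old x<)) (trans eq (old y<))))
                              (within B , bichromatic B)
  ; simple      = ((λ { (inj₁ (u≡w , _)) → <⇒≢ u<w u≡w ; (inj₂ (u≡v , _)) → u≢v u≡v }) ∷
                   All.map (λ { (x< , y<) (inj₁ (_ , w≡y)) → <⇒≢ y< (sym w≡y)
                              ; (x< , y<) (inj₂ (_ , w≡x)) → <⇒≢ x< (sym w≡x) }) (within B)) ∷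
                  All.map (λ { (x< , y<) (inj₁ (w≡x , _)) → <⇒≢ x< (sym w≡x)
                             ; (x< , y<) (inj₂ (w≡y , _)) → <⇒≢ y< (sym w≡y) }) (within B) ∷
                  simple B
  }
  where
  w = order G
  new : recolour w (not (c u)) c w ≡ not (c u)
  new = recolour-new w (not (c u)) c
  old : ∀ {x} → x < w → recolour w (not (c u)) c x ≡ c x
  old = recolour-old (not (c u)) c

curve-not-closed : ∀ {G u} → u < order G → ¬ 𝒫₄ (addCurve u u G)
curve-not-closed {G} {u} u<w girth = contradiction (girth 1 bigon) λ { (s≤s (s≤s ())) }
  where
  w = order G
  bigon : Cycle (addCurve u u G) 2
  bigon = record
    { vertex     = λ { zero → u ; (suc zero) → w }
    ; edge       = λ { zero → zero ; (suc zero) → suc zero }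
    ; vertex-inj = λ { {zero} {zero} _ → refl
                     ; {zero} {suc zero} u≡w → contradiction u≡w (<⇒≢ u<w)
                     ; {suc zero} {zero} w≡u → contradiction (sym w≡u) (<⇒≢ u<w)
                     ; {suc zero} {suc zero} _ → refl }
    ; edge-inj   = λ { {zero} {zero} _ → refl
                     ; {zero} {suc zero} ()
                     ; {suc zero} {zero} ()
                     ; {suc zero} {suc zero} _ → refl }
    ; joins      = λ { zero → inj₁ (refl , refl) ; (suc zero) → inj₁ (refl , refl) }
    }

curve-not-adjacent : ∀ {c G u v} → Bipartite c G → Adjacent G u v → ¬ 𝒫₄ (addCurve u v G)
curve-not-adjacent {c} {G} {u} {v} B uv girth = contradiction (girth 2 triangle) λ { (s≤s (s≤s (s≤s ()))) }
  where
  w = order G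
  u≢w = <⇒≢ (proj₁ (adjacent-within B uv))
  v≢w = <⇒≢ (proj₂ (adjacent-within B uv))
  u≢v : u ≢ v
  u≢v = adjacent-bichromatic B uv ∘ cong c
  triangle : Cycle (addCurve u v G) 3
  triangle = record
    { vertex     = λ { zero → u ; (suc zero) → w ; (suc (suc zero)) → v }
    ; edge       = λ { zero → zero ; (suc zero) → suc zero ; (suc (suc zero)) → suc (suc (Any.index uv)) }
    ; vertex-inj = λ { {zero} {zero} _ → refl
                     ; {zero} {suc zero} u≡w → contradiction u≡w u≢w
                     ; {zero} {suc (suc zero)} u≡v → contradiction u≡v u≢v
                     ; {suc zero} {zero} w≡u → contradiction (sym w≡u) u≢w
                     ; {suc zero} {suc zero} _ → refl
                     ; {suc zero} {suc (suc zero)} w≡v → contradiction (sym w≡v) v≢w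
                     ; {suc (suc zero)} {zero} v≡u → contradiction (sym v≡u) u≢v
                     ; {suc (suc zero)} {suc zero} v≡w → contradiction v≡w v≢w
                     ; {suc (suc zero)} {suc (suc zero)} _ → refl }
    ; edge-inj   = λ { {zero} {zero} _ → refl
                     ; {zero} {suc zero} ()
                     ; {zero} {suc (suc zero)} ()
                     ; {suc zero} {zero} ()
                     ; {suc zero} {suc zero} _ → refl
                     ; {suc zero} {suc (suc zero)} ()
                     ; {suc (suc zero)} {zero} ()
                     ; {suc (suc zero)} {suc zero} ()
                     ; {suc (suc zero)} {suc (suc zero)} _ → refl }
    ; joins      = λ { zero → inj₁ (refl , refl) ; (suc zero) → inj₁ (refl , refl)
                     ; (suc (suc zero)) → swap (lookup-index uv) }
    }

-- Regions and their cuts by a curve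

record Quadrilateral (c : ℕ → Bool) (G : Graph) (u x v y : ℕ) : Set where
  constructor quad
  field
    cu≡cv : c u ≡ c v
    cx≡cy : c x ≡ c y
    u≢v   : u ≢ v
    x≢y   : x ≢ y
    ux    : Adjacent G u x
    xv    : Adjacent G x v
    vy    : Adjacent G v y
    yu    : Adjacent G y u

record Monochromatic (c : ℕ → Bool) (G : Graph) (u w : ℕ) : Set where
  constructor mono
  field
    u<    : u < order G
    w<    : w < order G
    cu≡cw : c u ≡ c w
    u≢w   : u ≢ w

-- The region is cut open after a single tip. The placement of the new tip in `Move` leaves both
-- parts in this form again, so no rotation of lists is ever needed.
data HasShape (c : ℕ → Bool) (G : Graph) : Region → Shape → Set where
  square : ∀ p q {u x v y} → Quadrilateral c G u x v y →
           HasShape c G (replicate p u ++ x ∷ replicate q v ++ [ y ]) (square p q)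
  digon  : ∀ n {u w} → Monochromatic c G u w → HasShape c G (replicate n u ++ [ w ]) (digon n)
  dead   : ∀ n {u w} → Adjacent G u w → HasShape c G (replicate n u ++ [ w ]) dead

-- A `Split` with the positions of the joined tips: every legal move is one (`move-cut`), and every
-- `Split` is realised by one (`split-cut`).
data Cut (c : ℕ → Bool) (G : Graph) :
         Shape → (xs : List ℕ) (u : ℕ) (ys : List ℕ) (v : ℕ) (zs : List ℕ) → Shape → Shape → Set where
  chord : ∀ a b d e {u x v y} → Quadrilateral c G u x v y →
          Cut c G (square (a + suc b) (d + suc e))
              (replicate a u) u (replicate b u ++ x ∷ replicate d v) v (replicate e v ++ [ y ])
              (square b d) (square a e)
  cross : ∀ p q {u x v y} → Quadrilateral c G u x v y →
          Cut c G (square p q) (replicate p u) x (replicate q v) y [] (digon q) (digon p)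
  fold  : ∀ a b {u w} → Monochromatic c G u w →
          Cut c G (digon (a + suc b)) (replicate a u) u (replicate b u) w [] dead dead

cut-split : ∀ {c G s xs u ys v zs s₁ s₂} → Cut c G s xs u ys v zs s₁ s₂ → Split s s₁ s₂
cut-split (chord a b d e _) = chord b d a e (trans (+-suc a b) (cong suc (+-comm a b))) (+-suc d e)
cut-split (cross p q _)     = cross
cut-split (fold a b _)      = fold (+-suc a b)

replicate-+ : ∀ m n {u} {R : List ℕ} → replicate (m + n) u ++ R ≡ replicate m u ++ replicate n u ++ R
replicate-+ zero    n = refl
replicate-+ (suc m) n = cong (_ ∷_) (replicate-+ m n)

split-cut : ∀ {c G r s s₁ s₂} → HasShape c G r s → Split s s₁ s₂ →
            ∃[ xs ] ∃[ u ] ∃[ ys ] ∃[ v ] ∃[ zs ]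
              (r ≡ xs ++ u ∷ ys ++ v ∷ zs × Cut c G s xs u ys v zs s₁ s₂)
split-cut {c} {G} (square _ _ {u} {x} {v} {y} Q) (chord a b d e refl refl) =
  replicate d u , u , replicate a u ++ x ∷ replicate b v , v , replicate e v ++ [ y ] ,
  trans (cong (λ n → replicate n u ++ x ∷ replicate (suc (b + e)) v ++ [ y ]) p≡)
    (trans (cong (λ n → replicate (d + suc a) u ++ x ∷ replicate n v ++ [ y ]) (sym (+-suc b e)))
      (trans (replicate-+ d (suc a)) (cong (λ l → replicate d u ++ u ∷ l)
        (trans (cong (λ l → replicate a u ++ x ∷ l) (replicate-+ b (suc e)))
               (sym (++-assoc (replicate a u) (x ∷ replicate b v) _)))))) ,
  subst₂ (λ p q → Cut c G (square p q) (replicate d u) u (replicate a u ++ x ∷ replicate b v)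
                          v (replicate e v ++ [ y ]) (square a b) (square d e))
         (sym p≡) (+-suc b e) (chord d a b e Q)
  where
  p≡ : suc (a + d) ≡ d + suc a
  p≡ = trans (cong suc (+-comm a d)) (sym (+-suc d a))
split-cut (square p q Q) cross       = -, -, -, -, -, refl , cross p q Q
-- Any tip of `u` would do, both parts being dead; the first is taken.
split-cut (digon _ M)    (fold {m = m} refl) = -, -, -, -, -, refl , fold 0 m M

cut-tips : ∀ {c G s xs u ys v zs s₁ s₂} → Bipartite c G → Cut c G s xs u ys v zs s₁ s₂ →
           Monochromatic c G u v
cut-tips B (chord _ _ _ _ (quad cu≡cv _ u≢v _ ux xv _ _)) =
  mono (proj₁ (adjacent-within B ux)) (proj₂ (adjacent-within B xv)) cu≡cv u≢v
cut-tips B (cross _ _ (quad _ cx≡cy _ x≢y ux _ vy _)) =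
  mono (proj₂ (adjacent-within B ux)) (proj₂ (adjacent-within B vy)) cx≡cy x≢y
cut-tips B (fold _ _ M) = M

module _ {c G u v} (B : Bipartite c G) (M : Monochromatic c G u v) where

  private
    w  = order G
    c′ = recolour w (not (c u)) c
    G′ = addCurve u v G
    new : c′ w ≡ not (c u)
    new = recolour-new w (not (c u)) c
    old : ∀ {x} → x < w → c′ x ≡ c x
    old = recolour-old (not (c u)) c
    keep : ∀ {x y} → Adjacent G x y → Adjacent G′ x y
    keep xy = there (there xy)
    keep-≡ : ∀ {x y} → x < w → y < w → c x ≡ c y → c′ x ≡ c′ y
    keep-≡ x< y< eq = trans (old x<) (trans eq (sym (old y<)))
    opposite : ∀ {x} → Adjacent G u x → c′ x ≡ c′ w
    opposite {x} ux = trans (old (proj₂ (adjacent-within B ux)))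
      (trans (¬-not (adjacent-bichromatic B ux ∘ sym)) (sym new))
    uw : Adjacent G′ u w
    uw = here (inj₁ (refl , refl))
    wv : Adjacent G′ w v
    wv = there (here (inj₁ (refl , refl)))

  HasShape-addCurve : ∀ {r s} → HasShape c G r s → HasShape c′ G′ r s
  HasShape-addCurve (square p q (quad cu cx u≢v x≢y ux xv vy yu)) = square p q
    (quad (keep-≡ (proj₁ (adjacent-within B ux)) (proj₂ (adjacent-within B xv)) cu)
          (keep-≡ (proj₂ (adjacent-within B ux)) (proj₂ (adjacent-within B vy)) cx)
          u≢v x≢y (keep ux) (keep xv) (keep vy) (keep yu))
  HasShape-addCurve (digon n (mono u< w< cu≡cw u≢w)) =
    digon n (mono (m<n⇒m<1+n u<) (m<n⇒m<1+n w<) (keep-≡ u< w< cu≡cw) u≢w)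
  HasShape-addCurve (dead n uw) = dead n (keep uw)

  -- The new vertex is adjacent to both joined corners. In a `chord` it replaces `y` in one part and
  -- `x` in the other; in a `cross` it has the colour of the other two corners, which are also
  -- neighbours of the joined ones.
  cut-parts : ∀ {s xs ys zs s₁ s₂} → Cut c G s xs u ys v zs s₁ s₂ →
              HasShape c′ G′ (ys ++ [ w ]) s₁ × HasShape c′ G′ (xs ++ w ∷ zs) s₂
  cut-parts (chord a b d e {x = x} (quad cu≡cv cx≡cy u≢v x≢y ux xv vy yu)) =
    subst (λ r → HasShape c′ G′ r (square b d)) (sym (++-assoc (replicate b u) (x ∷ replicate d v) _))
      (square b d (quad (keep-≡ u< v< cu≡cv) (opposite ux) u≢v (<⇒≢ (proj₂ (adjacent-within B ux)))
        (keep ux) (keep xv) (Adjacent-sym {G′} wv) (Adjacent-sym {G′} uw))) ,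
    square a e (quad (keep-≡ u< v< cu≡cv) (sym (opposite (Adjacent-sym {G} yu))) u≢v
      (<⇒≢ (proj₁ (adjacent-within B yu)) ∘ sym) uw wv (keep vy) (keep yu))
    where
    u< = Monochromatic.u< M
    v< = Monochromatic.w< M
  cut-parts (cross p q (quad cu≡cv cx≡cy _ _ ux xv _ _)) =
    digon q (part xv) , digon p (part (Adjacent-sym {G} ux))
    where
    part : ∀ {z} → Adjacent G u z → Monochromatic c′ G′ z w
    part uz = mono (m<n⇒m<1+n z<) ≤-refl (opposite uz) (<⇒≢ z<)
      where z< = proj₂ (adjacent-within B uz)
  cut-parts (fold a b _) = dead b uw , dead a uw

-- Legal moves within a region

∷-pick : ∀ {x : ℕ} {R} xs {t ys} → x ∷ R ≡ xs ++ t ∷ ys →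
         (xs ≡ [] × t ≡ x × ys ≡ R) ⊎ (∃[ xs′ ] (xs ≡ x ∷ xs′ × R ≡ xs′ ++ t ∷ ys))
∷-pick []       refl = inj₁ (refl , refl , refl)
∷-pick (_ ∷ xs) refl = inj₂ (xs , refl , refl)

replicate-pick : ∀ n {u : ℕ} {R} xs {t ys} → replicate n u ++ R ≡ xs ++ t ∷ ys →
  (∃[ a ] ∃[ b ] (n ≡ a + suc b × xs ≡ replicate a u × t ≡ u × ys ≡ replicate b u ++ R)) ⊎
  (∃[ xs′ ] (xs ≡ replicate n u ++ xs′ × R ≡ xs′ ++ t ∷ ys))
replicate-pick zero    xs eq = inj₂ (xs , refl , eq)
replicate-pick (suc n) xs eq with ∷-pick xs eq
... | inj₁ (refl , refl , refl) = inj₁ (0 , n , refl , refl , refl , refl)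
... | inj₂ (xs′ , refl , eq′) with replicate-pick n xs′ eq′
...   | inj₁ (a , b , refl , refl , refl , refl) = inj₁ (suc a , b , refl , refl , refl , refl)
...   | inj₂ (xs″ , refl , eq″) = inj₂ (xs″ , refl , eq″)

[]-pick : ∀ xs {t : ℕ} {ys} → [] ≢ xs ++ t ∷ ys
[]-pick []      ()
[]-pick (_ ∷ _) ()

[-]-pick : ∀ {y : ℕ} xs {t ys} → [ y ] ≡ xs ++ t ∷ ys → xs ≡ [] × t ≡ y × ys ≡ []
[-]-pick xs eq with ∷-pick xs eq
... | inj₁ last = last
... | inj₂ (xs′ , _ , eq′) = contradiction eq′ ([]-pick xs′)

module _ {c G} (B : Bipartite c G) where

  private
    closed : ∀ {u} {A : Set} → u < order G → 𝒫₄ (addCurve u u G) → A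
    closed u< girth = contradiction girth (curve-not-closed u<)
    adjacent : ∀ {u v} {A : Set} → Adjacent G u v → 𝒫₄ (addCurve u v G) → A
    adjacent uv girth = contradiction girth (curve-not-adjacent B uv)

  -- By the positions of the two tips: at one corner the curve closes a bigon, at adjacent corners a
  -- triangle, and the remaining positions are the cuts.
  move-cut : ∀ {r s} → HasShape c G r s → ∀ xs {u} ys {v zs} → r ≡ xs ++ u ∷ ys ++ v ∷ zs →
             𝒫₄ (addCurve u v G) → ∃[ s₁ ] ∃[ s₂ ] Cut c G s xs u ys v zs s₁ s₂
  move-cut (square p q Q@(quad _ _ _ _ ux xv vy yu)) xs ys eq girth with replicate-pick p xs eq
  ... | inj₁ (a , b , refl , refl , refl , eq′) with replicate-pick b ys (sym eq′)
  ...   | inj₁ (_ , _ , _ , _ , refl , _) = closed (proj₁ (adjacent-within B ux)) girth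
  ...   | inj₂ (ys′ , refl , eq″) with ∷-pick ys′ eq″
  ...     | inj₁ (_ , refl , _) = adjacent ux girth
  ...     | inj₂ (ys″ , refl , eq‴) with replicate-pick q ys″ eq‴
  ...       | inj₁ (d , e , refl , refl , refl , refl) = -, -, chord a b d e Q
  ...       | inj₂ (ys‴ , refl , eq⁗) with [-]-pick ys‴ eq⁗
  ...         | _ , refl , _ = adjacent (Adjacent-sym {G} yu) girth
  move-cut (square p q Q@(quad _ _ _ _ ux xv vy yu)) xs ys eq girth
      | inj₂ (xs′ , refl , eq′) with ∷-pick xs′ eq′
  ... | inj₁ (refl , refl , eq″) with replicate-pick q ys (sym eq″)
  ...   | inj₁ (_ , _ , _ , _ , refl , _) = adjacent xv girth
  ...   | inj₂ (ys′ , refl , eq‴) with [-]-pick ys′ eq‴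
  ...     | refl , refl , refl = -, -,
    subst₂ (λ xs ys → Cut c G (square p q) xs _ ys _ [] (digon q) (digon p))
           (sym (++-identityʳ _)) (sym (++-identityʳ _)) (cross p q Q)
  move-cut (square p q Q@(quad _ _ _ _ ux xv vy yu)) xs ys eq girth
      | inj₂ (xs′ , refl , eq′) | inj₂ (xs″ , refl , eq″) with replicate-pick q xs″ eq″
  ... | inj₂ (xs‴ , refl , eq‴) =
    contradiction (sym (proj₂ (proj₂ ([-]-pick xs‴ eq‴)))) ([]-pick ys)
  ... | inj₁ (_ , e , refl , refl , refl , eq‴) with replicate-pick e ys (sym eq‴)
  ...   | inj₁ (_ , _ , _ , _ , refl , _) = closed (proj₂ (adjacent-within B xv)) girth
  ...   | inj₂ (ys′ , refl , eq⁗) with [-]-pick ys′ eq⁗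
  ...     | _ , refl , _ = adjacent vy girth
  move-cut (digon n M) xs ys eq girth with replicate-pick n xs eq
  ... | inj₂ (xs′ , refl , eq′) =
    contradiction (sym (proj₂ (proj₂ ([-]-pick xs′ eq′)))) ([]-pick ys)
  ... | inj₁ (a , b , refl , refl , refl , eq′) with replicate-pick b ys (sym eq′)
  ...   | inj₁ (_ , _ , _ , _ , refl , _) = closed (Monochromatic.u< M) girth
  ...   | inj₂ (ys′ , refl , eq″) with [-]-pick ys′ eq″
  ...     | refl , refl , refl = -, -,
    subst (λ ys → Cut c G (digon (a + suc b)) _ _ ys _ [] dead dead)
          (sym (++-identityʳ _)) (fold a b M)
  move-cut (dead n uw) xs ys eq girth with replicate-pick n xs eq
  ... | inj₂ (xs′ , refl , eq′) =
    contradiction (sym (proj₂ (proj₂ ([-]-pick xs′ eq′)))) ([]-pick ys)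
  ... | inj₁ (a , b , refl , refl , refl , eq′) with replicate-pick b ys (sym eq′)
  ...   | inj₁ (_ , _ , _ , _ , refl , _) = closed (proj₁ (adjacent-within B uw)) girth
  ...   | inj₂ (ys′ , refl , eq″) with [-]-pick ys′ eq″
  ...     | _ , refl , _ = adjacent uw girth

-- Bisimulation of drawings and lists of shapes

infix 4 _~_
_~_ : Position → List Shape → Set
P ~ ss = ∃[ c ] (Bipartite c (graph P) × Pointwise (HasShape c (graph P)) (regions P) ss)

replace : ∀ {R R′ : Region → Shape → Set} {r r₁ r₂} → (∀ {q s} → R q s → R′ q s) →
          (∀ {s} → R r s → ∃[ s₁ ] ∃[ s₂ ] (Split s s₁ s₂ × R′ r₁ s₁ × R′ r₂ s₂)) →
          ∀ ls {rs ss} → Pointwise R (ls ++ r ∷ rs) ss →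
          ∃[ ss′ ] (ss ⇒ ss′ × Pointwise R′ (ls ++ r₁ ∷ r₂ ∷ rs) ss′)
replace keep cut []       (h ∷ hs) =
  let _ , _ , split , h₁ , h₂ = cut h in -, here split , h₁ ∷ h₂ ∷ Pointwise.map keep hs
replace keep cut (_ ∷ ls) (h ∷ hs) =
  let _ , move , hs′ = replace keep cut ls hs in -, there move , keep h ∷ hs′

-- The rebuilding function is polymorphic in `R′` since a move changes the graph and the colouring
-- that the relation refers to.
locate : ∀ {R : Region → Shape → Set} {rs ss ss′} → Pointwise R rs ss → ss ⇒ ss′ →
         ∃[ ls ] ∃[ r ] ∃[ rs′ ] ∃[ s ] ∃[ s₁ ] ∃[ s₂ ]
           (rs ≡ ls ++ r ∷ rs′ × R r s × Split s s₁ s₂ ×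
            (∀ {R′ : Region → Shape → Set} {r₁ r₂} → (∀ {q s} → R q s → R′ q s) →
             R′ r₁ s₁ → R′ r₂ s₂ → Pointwise R′ (ls ++ r₁ ∷ r₂ ∷ rs′) ss′))
locate (h ∷ hs) (here split) =
  [] , -, -, -, -, -, refl , h , split , λ keep h₁ h₂ → h₁ ∷ h₂ ∷ Pointwise.map keep hs
locate (h ∷ hs) (there move) =
  let ls , _ , _ , _ , _ , _ , eq , hr , split , rebuild = locate hs move in
  _ ∷ ls , -, -, -, -, -, cong (_ ∷_) eq , hr , split , λ keep h₁ h₂ → keep h ∷ rebuild keep h₁ h₂

~-forth : ∀ {P P′ ss} → P ~ ss → Move 𝒫₄ P P′ → ∃[ ss′ ] (ss ⇒ ss′ × P′ ~ ss′)
~-forth {ss = ss} (c , B , hs) (join ls rs xs ys zs u v eq girth) =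
  let hs₀ = subst (λ rs → Pointwise (HasShape c _) rs ss) eq hs
      M   = tips ls hs₀
      ss′ , move , hs′ = replace (HasShape-addCurve B M)
        (λ h → let s₁ , s₂ , cut = move-cut B h xs ys refl girth in
               s₁ , s₂ , cut-split cut , cut-parts B M cut) ls hs₀
  in ss′ , move , -, addCurve-bipartite B (Monochromatic.u< M) (Monochromatic.w< M)
                       (Monochromatic.u≢w M) (Monochromatic.cu≡cw M) , hs′
  where
  tips : ∀ ls {rs ss} → Pointwise (HasShape c _) (ls ++ (xs ++ u ∷ ys ++ v ∷ zs) ∷ rs) ss →
         Monochromatic c _ u v
  tips []       (h ∷ _)  = let _ , _ , cut = move-cut B h xs ys refl girth in cut-tips B cut
  tips (_ ∷ ls) (_ ∷ hs) = tips ls hs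

~-back : ∀ {P ss ss′} → P ~ ss → ss ⇒ ss′ → ∃[ P′ ] (Move 𝒫₄ P P′ × P′ ~ ss′)
~-back {P} (c , B , hs) move =
  let ls , r , rs , s , s₁ , s₂ , eq , h , split , rebuild = locate hs move
      xs , u , ys , v , zs , r≡ , cut = split-cut h split
      M = cut-tips B cut
      B′ = addCurve-bipartite B (Monochromatic.u< M) (Monochromatic.w< M)
                                (Monochromatic.u≢w M) (Monochromatic.cu≡cw M)
      h₁ , h₂ = cut-parts B M cut
  in -, join ls rs xs ys zs u v (trans eq (cong (λ r → ls ++ r ∷ rs) r≡)) (bipartite⇒𝒫₄ B′) ,
     -, B′ , rebuild (HasShape-addCurve B M) h₁ h₂

~⇒Nimber : ∀ {P ss} → P ~ ss → Nimber (Move 𝒫₄) P (nimValue ss)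
~⇒Nimber {ss = ss} P~ss = Nimber-bisimulation _~_ ~-forth ~-back P~ss (shapes-nimber ss)

start~square : ∀ p q → Game.start (CS 4 𝒫₄ (p ∷ 1 ∷ q ∷ 1 ∷ [])) ~ [ square p q ]
-- Parity colours the circle 0, 1, 2, 3 properly.
start~square p q = odd ,
  record
    { within      = (s≤s z≤n , s≤s (s≤s z≤n)) ∷ (s≤s (s≤s z≤n) , s≤s (s≤s (s≤s z≤n))) ∷
                    (s≤s (s≤s (s≤s z≤n)) , ≤-refl) ∷ (≤-refl , s≤s z≤n) ∷ []
    ; bichromatic = (λ ()) ∷ (λ ()) ∷ (λ ()) ∷ (λ ()) ∷ []
    ; simple      = ((λ { (inj₁ (() , _)) ; (inj₂ (() , _)) }) ∷ (λ { (inj₁ (() , _)) ; (inj₂ (() , _)) }) ∷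
                     (λ { (inj₁ (() , _)) ; (inj₂ (_ , ())) }) ∷ []) ∷
                    ((λ { (inj₁ (() , _)) ; (inj₂ (() , _)) }) ∷ (λ { (inj₁ (() , _)) ; (inj₂ (() , _)) }) ∷ []) ∷
                    ((λ { (inj₁ (() , _)) ; (inj₂ (() , _)) }) ∷ []) ∷ [] ∷ []
    } ,
  square p q (quad refl refl (λ ()) (λ ())
    (here (inj₁ (refl , refl))) (there (here (inj₁ (refl , refl))))
    (there (there (here (inj₁ (refl , refl))))) (there (there (there (here (inj₁ (refl , refl))))))) ∷ []

η-square : ∀ p q {k} → grundy (square p q) ≡ k → η[ CS 4 𝒫₄ (p ∷ 1 ∷ q ∷ 1 ∷ []) ]= k
η-square p q eq =
  subst (Nimber (Move 𝒫₄) _) (trans (⊕-identityʳ _) eq) (~⇒Nimber (start~square p q))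

-- From the integers of the statement to natural numbers

minus-plus : ∀ m e → (+ m) ℤ.- (+ e) ℤ.+ (+ e) ≡ + m
minus-plus m e = trans (ℤ.+-assoc (+ m) (ℤ.- (+ e)) (+ e))
    (trans (cong (λ i → (+ m) ℤ.+ i) (ℤ.+-inverseˡ (+ e))) (ℤ.+-identityʳ (+ m)))

<-minus⇒+-< : ∀ q m e → (+ q) ℤ.< (+ m) ℤ.- (+ e) → q + e < m
<-minus⇒+-< q m e h = ℤ.drop‿+<+ (subst (λ i → (+ (q + e)) ℤ.< i) (minus-plus m e) (ℤ.+-monoˡ-< (+ e) h))

minus-≤⇒≤-+ : ∀ q m e → (+ m) ℤ.- (+ e) ℤ.≤ (+ q) → m ≤ q + e
minus-≤⇒≤-+ q m e h = ℤ.drop‿+≤+ (subst (λ i → i ℤ.≤ (+ (q + e))) (minus-plus m e) (ℤ.+-monoˡ-≤ (+ e) h))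

residue-quotient : ∀ s i → 1 ≤ s → 1 ≤ i → i ≤ 5 → i % 5 ≡ s % 5 → ∃[ m ] s ≡ i + m * 5
residue-quotient s 1 _ _ _ eq = s / 5 , trans (m≡m%n+[m/n]*n s 5) (cong (_+ s / 5 * 5) (sym eq))
residue-quotient s 2 _ _ _ eq = s / 5 , trans (m≡m%n+[m/n]*n s 5) (cong (_+ s / 5 * 5) (sym eq))
residue-quotient s 3 _ _ _ eq = s / 5 , trans (m≡m%n+[m/n]*n s 5) (cong (_+ s / 5 * 5) (sym eq))
residue-quotient s 4 _ _ _ eq = s / 5 , trans (m≡m%n+[m/n]*n s 5) (cong (_+ s / 5 * 5) (sym eq))
-- For `i = 5` the residue is 0, so one block of 5 is taken out of the quotient; `1 ≤ s` ensures
-- that there is one.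
residue-quotient s 5 1≤s _ _ eq with s / 5 | trans (m≡m%n+[m/n]*n s 5) (cong (_+ s / 5 * 5) (sym eq))
... | zero  | s≡0 = contradiction (subst (1 ≤_) s≡0 1≤s) λ ()
... | suc m | s≡  = m , s≡
residue-quotient s (suc (suc (suc (suc (suc (suc i)))))) _ _ (s≤s (s≤s (s≤s (s≤s (s≤s ()))))) _

theorem5p1 : (p q i : ℕ) → p ≤ q → 1 ≤ i → i ≤ 5 → i % 5 ≡ (p + q) % 5 →
    (p ≡ q →
    η[ CS 4 𝒫₄ (p ∷ 1 ∷ q ∷ 1 ∷ []) ]= 1) ×
    (p < q → (+ q) ℤ.< (+ (2 * p)) ℤ.- (+ (∣ p - 2 ∣ / 2)) →
    η[ CS 4 𝒫₄ (p ∷ 1 ∷ q ∷ 1 ∷ []) ]= (4 * ((p + q ∸ i) / 5) + 2 * (i / 4))) ×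
    (p < q → (+ (2 * p)) ℤ.- (+ (∣ p - 2 ∣ / 2)) ℤ.≤ (+ q) →
    η[ CS 4 𝒫₄ (p ∷ 1 ∷ q ∷ 1 ∷ []) ]= (2 * p))
theorem5p1 p q i _ 1≤i i≤5 i≡s =
  (λ p≡q → η-square p q (grundy-diagonal p≡q)) ,
  (λ p<q h → η-square p q (trans (grundy-off-diagonal (<⇒≢ p<q)) (balanced p<q h))) ,
  (λ p<q h → η-square p q (trans (grundy-off-diagonal (<⇒≢ p<q))
    (trans (cong (false ∷₂_) (H-unbalanced p q p<q (minus-≤⇒≤-+ q (2 * p) (∣ p - 2 ∣ / 2) h)))
           (cong (_+_ p) (sym (+-identityʳ p))))))
  where
  balanced : p < q → (+ q) ℤ.< (+ (2 * p)) ℤ.- (+ (∣ p - 2 ∣ / 2)) →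
             false ∷₂ H p q ≡ 4 * ((p + q ∸ i) / 5) + 2 * (i / 4)
  balanced p<q h with residue-quotient (p + q) i (≤-trans (≤-trans (s≤s z≤n) p<q) (m≤n+m q p)) 1≤i i≤5 i≡s
  ... | m , s≡ = begin
    H p q + H p q                             ≡⟨ cong (false ∷₂_) (H-balanced p q m i p<q 1≤i i≤5 s≡
                                                   (<-minus⇒+-< q (2 * p) (∣ p - 2 ∣ / 2) h)) ⟩
    (2 * m + i / 4) + (2 * m + i / 4)         ≡⟨ double m (i / 4) ⟩
    4 * m + 2 * (i / 4)                       ≡⟨ cong (λ m → 4 * m + 2 * (i / 4)) quotient ⟨
    4 * ((p + q ∸ i) / 5) + 2 * (i / 4)       ∎
    where
    open ≡-Reasoning
    double : ∀ m f → (2 * m + f) + (2 * m + f) ≡ 4 * m + 2 * f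
    double = solve-∀
    quotient : (p + q ∸ i) / 5 ≡ m
    quotient = trans (/-congˡ (trans (cong (_∸ i) s≡) (m+n∸m≡n i (m * 5)))) (m*n/n≡m m 5)
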